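{- Let $p$ be an odd prime and let $g,n$ be positive integers with $g\mid p(p-1)$. If $$n\le p-1-\left\lfloor \frac{g}{2}\right\rfloor,\qquad n=ag+r,\qquad 0\le r<g,$$ with $a,r$ integers, then $$G(g,n)\le \frac{p(p-1)}{g}-\left\lceil \frac{\frac{p(p-1)}{g}+\frac{g a(a-1)}2+ra}{n}\right\rceil.$$
   Context: A finite set $\mathcal{G}\subset\mathbb{Z}$ is a $g$-Golomb ruler if for every positive integer $d$ the number of pairs $(a,c)\in \mathcal{G}^2$ with $c-a=d$ is at most $g$. $G(g,n)$ denotes the minimum possible diameter (largest element minus smallest element) of a $g$-Golomb ruler with exactly $n$ elements (marks). -}

module Defs where

open import Data.Integer using (ℤ; +_; _-_; _≤_; _≟_)
open import Data.List using (List; length; filter; cartesianProduct)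
open import Data.List.Membership.Propositional using (_∈_)
open import Data.List.Relation.Unary.All using (All)
open import Data.List.Relation.Unary.Unique.Propositional using (Unique)
open import Data.Nat as ℕ using (ℕ)
open import Data.Product using (_×_; _,_; ∃-syntax)
open import Relation.Binary.PropositionalEquality using (_≡_)

-- Finite sets of integers are represented by duplicate-free lists (in any
-- order), so that `length` is the cardinality and, in `differenceCount`, each
-- pair (a , c) ∈ 𝒢² is counted once.

differenceCount : ℤ → List ℤ → ℕ
differenceCount d 𝒢 =
  length (filter (λ (a , c) → (c - a) ≟ d) (cartesianProduct 𝒢 𝒢))

record IsGolombRuler (g : ℕ) (𝒢 : List ℤ) : Set where
  field
    unique  : Unique 𝒢
    bounded : ∀ (d : ℕ) → 0 ℕ.< d → differenceCount (+ d) 𝒢 ℕ.≤ g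

-- Never satisfied by the empty list.
record HasDiameter (𝒢 : List ℤ) (D : ℕ) : Set where
  field
    min max    : ℤ
    min∈       : min ∈ 𝒢
    max∈       : max ∈ 𝒢
    min≤       : All (min ≤_) 𝒢
    ≤max       : All (_≤ max) 𝒢
    difference : max - min ≡ + D

IsRulerDiameter : (g n D : ℕ) → Set
IsRulerDiameter g n D =
  ∃[ 𝒢 ] IsGolombRuler g 𝒢 × length 𝒢 ≡ n × HasDiameter 𝒢 D

-- `IsG g n m` says that G(g, n) exists and equals m; such an m is unique by
-- antisymmetry of ≤.
record IsG (g n m : ℕ) : Set where
  field
    attained : IsRulerDiameter g n m
    minimal  : ∀ {D} → IsRulerDiameter g n D → m ℕ.≤ D

{-# OPTIONS --safe #-}

-- Let θ be a primitive root modulo p. Ruzsa's residues R i modulo p (p - 1), given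
-- by R i ≡ i (mod p - 1) and R i ≡ θ ^ i (mod p), form a Sidon set: if
-- R i - R j ≡ R k - R l, then A = θ ^ i, B = θ ^ j, C = θ ^ k, D = θ ^ l satisfy
-- A - B ≡ C - D and A D ≡ C B, whence (A - B)(D - B) ≡ 0 (mod p).
-- Write p (p - 1) = g M. Modulo M each difference occurs at most g times, since it
-- has g lifts modulo g M; for the difference 0 this shows that at most ⌊ g /2⌋
-- residues are lost to collisions. Choose n of the remaining residues. Their cyclic
-- gaps add up to M, and each value occurs at most g times among them. So if ℓ is the
-- largest gap, the n deficits ℓ - gap add up to at least g a (a - 1) / 2 + r a, and
-- M + g a (a - 1) / 2 + r a ≤ n ℓ. Cutting the circle at the largest gap leaves a
-- ruler of diameter M - ℓ.

module Submission where

open import Defs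
open import Data.Fin as Fin using (Fin; toℕ)
import Data.Fin.Properties as Fin
open import Data.Integer as ℤ using (ℤ; +_; 0ℤ; 1ℤ; -1ℤ)
import Data.Integer.Divisibility.Signed as ℤ
import Data.Integer.DivMod as ℤ
import Data.Integer.Properties as ℤ
open import Data.Integer.Tactic.RingSolver using (solve-∀)
open import Data.List as List
  using (List; []; _∷_; _++_; length; map; filter; take; upTo; lookup; cartesianProduct; cartesianProductWith)
open import Data.List.Extrema.Nat using (argmax; argmax-all; f[⊥]≤f[argmax]; f[xs]≤f[argmax])
open import Data.List.Membership.Propositional using (_∈_; find; lose)
open import Data.List.Membership.Propositional.Properties
  using ( ∈-lookup; ∈-map⁺; ∈-map⁻; ∈-upTo⁺; ∈-upTo⁻; ∈-filter⁻
        ; ∈-cartesianProduct⁻; ∈-cartesianProductWith⁺)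
open import Data.List.Properties
  using ( length-filter; length-map; length-upTo; length-applyUpTo; length-take; map-∘; map-++
        ; filter-accept; filter-reject; filter-none; filter-≐)
open import Data.List.Relation.Binary.Permutation.Propositional using (↭-sym; ↭⇒↭ₛ)
open import Data.List.Relation.Binary.Permutation.Propositional.Properties using (All-resp-↭; ↭-length)
open import Data.List.Relation.Binary.Permutation.Setoid.Properties using (Unique-resp-↭)
open import Data.List.Relation.Unary.All as All using (All; []; _∷_)
import Data.List.Relation.Unary.All.Properties as All
open import Data.List.Relation.Unary.AllPairs as AllPairs using (AllPairs; []; _∷_)
import Data.List.Relation.Unary.AllPairs.Properties as AllPairs
open import Data.List.Relation.Unary.Any as Any using (Any; here; there; any?)
open import Data.List.Relation.Unary.Any.Properties using (lookup-result)
open import Data.List.Relation.Unary.Sorted.TotalOrder.Properties using (Sorted⇒AllPairs)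
open import Data.List.Relation.Unary.Unique.Propositional using (Unique)
import Data.List.Relation.Unary.Unique.Propositional.Properties as Unique
open import Data.Nat
  using ( ℕ; zero; suc; NonZero; NonTrivial; _+_; _*_; _∸_; _^_; _/_; _%_; ⌊_/2⌋; _≤_; _<_
        ; z≤n; s≤s; s≤s⁻¹; z<s; nonTrivial⇒n>1; >-nonZero; >-nonZero⁻¹)
open import Data.Nat.Coprimality as Coprime using (Coprime)
open import Data.Nat.Divisibility
open import Data.Nat.DivMod using (m≡m%n+[m/n]*n; m%n<n; m/n*n≤m; m*[n/m]≡n)
open import Data.Nat.GCD using (gcd; gcd[m,n]∣m; gcd[m,n]∣n; gcd-greatest)
open import Data.Nat.Induction using (<-wellFounded)
open import Data.Nat.ListAction using (product; sum)
open import Data.Nat.Primality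
  using (Prime; euclidsLemma; ¬prime[0]; prime⇒nonZero; prime⇒nonTrivial; prime⇒irreducible)
open import Data.Nat.Primality.Factorisation using (factorise)
open import Data.Nat.Properties
import Data.Nat.Tactic.RingSolver as ℕ
open import Data.List.Sort ≤-decTotalOrder using (sort; sort-↭; sort-↗)
open import Data.Product as Product using (_×_; _,_; ∃-syntax; proj₁; proj₂)
open import Data.Rational.Unnormalised as ℚᵘ using (ceiling)
open import Data.Sum as Sum using (_⊎_; inj₁; inj₂)
open import Data.Vec using (Vec; []; _∷_; replicate)
open import Function using (_∘_; id; it)
open import Induction.WellFounded using (Acc; acc)
open import Relation.Binary.Definitions using (tri<; tri≈; tri>)
open import Relation.Binary.PropositionalEquality
open import Relation.Nullary using (¬_; Dec; yes; no; contradiction)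
open import Relation.Nullary.Decidable as Dec using (_×-dec_; _→-dec_; ¬?)
open import Relation.Unary using (Pred; Decidable)

-- The Sidon property says nothing about a pair `a = b`, so all counting is of ordered pairs of
-- distinct elements, and the difference 0 modulo `M` plays two roles. A collision of two distinct
-- elements of the Sidon set does count, once in each order, which is where the half of `g` comes
-- from. A gap equal to `M`, however, is the difference of a residue with itself, and no Sidon
-- argument bounds it. It arises only when there is a single residue, and then `1 ≤ g` suffices. Two
-- existence questions remain. A primitive root is reached by repeatedly trading an element for one
-- of larger order. The existence of `G(g, n)` is part of the conclusion, and finding a least
-- diameter constructively requires deciding whether a ruler of a given diameter exists, which
-- becomes a finite search.

-- Congruences between integers

infix 4 _≅_[mod_] _≅?_[mod_]

-- The quotient is carried explicitly: matching the equation with `refl` eliminates the left side,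
-- and the closure properties become ring identities with visible witnesses.
record _≅_[mod_] (x y : ℤ) (m : ℕ) : Set where
  constructor mk≅
  field
    quotient : ℤ
    equality : x ≡ y ℤ.+ quotient ℤ.* + m

module _ {m : ℕ} where

  private variable
    x y z w : ℤ

  ≅⇒∣ : x ≅ y [mod m ] → + m ℤ.∣ x ℤ.- y
  ≅⇒∣ {y = y} (mk≅ k refl) = ℤ.divides k (cancel y k (+ m))
    where
    cancel : ∀ y k m → y ℤ.+ k ℤ.* m ℤ.- y ≡ k ℤ.* m
    cancel = solve-∀

  ∣⇒≅ : + m ℤ.∣ x ℤ.- y → x ≅ y [mod m ]
  ∣⇒≅ {x} {y} (ℤ.divides k x-y≡km) = mk≅ k (trans (split x y) (cong (ℤ._+_ y) x-y≡km))
    where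
    split : ∀ x y → x ≡ y ℤ.+ (x ℤ.- y)
    split = solve-∀

  ≅-reflexive : x ≡ y → x ≅ y [mod m ]
  ≅-reflexive {x} refl = mk≅ 0ℤ (sym (ℤ.+-identityʳ x))

  ≅-refl : x ≅ x [mod m ]
  ≅-refl = ≅-reflexive refl

  ≅-sym : x ≅ y [mod m ] → y ≅ x [mod m ]
  ≅-sym {y = y} (mk≅ k refl) = mk≅ (ℤ.- k) (cancel y k (+ m))
    where
    cancel : ∀ y k m → y ≡ y ℤ.+ k ℤ.* m ℤ.+ ℤ.- k ℤ.* m
    cancel = solve-∀

  ≅-trans : x ≅ y [mod m ] → y ≅ z [mod m ] → x ≅ z [mod m ]
  ≅-trans {z = z} (mk≅ k refl) (mk≅ l refl) = mk≅ (k ℤ.+ l) (collect z k l (+ m))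
    where
    collect : ∀ z k l m → z ℤ.+ l ℤ.* m ℤ.+ k ℤ.* m ≡ z ℤ.+ (k ℤ.+ l) ℤ.* m
    collect = solve-∀

  +-cong : x ≅ y [mod m ] → z ≅ w [mod m ] → x ℤ.+ z ≅ y ℤ.+ w [mod m ]
  +-cong {y = y} {w = w} (mk≅ k refl) (mk≅ l refl) = mk≅ (k ℤ.+ l) (collect y w k l (+ m))
    where
    collect : ∀ y w k l m → y ℤ.+ k ℤ.* m ℤ.+ (w ℤ.+ l ℤ.* m) ≡ y ℤ.+ w ℤ.+ (k ℤ.+ l) ℤ.* m
    collect = solve-∀

  *-cong : x ≅ y [mod m ] → z ≅ w [mod m ] → x ℤ.* z ≅ y ℤ.* w [mod m ]
  *-cong {y = y} {w = w} (mk≅ k refl) (mk≅ l refl) =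
    mk≅ (k ℤ.* w ℤ.+ y ℤ.* l ℤ.+ k ℤ.* l ℤ.* + m) (collect y w k l (+ m))
    where
    collect : ∀ y w k l m → (y ℤ.+ k ℤ.* m) ℤ.* (w ℤ.+ l ℤ.* m) ≡
              y ℤ.* w ℤ.+ (k ℤ.* w ℤ.+ y ℤ.* l ℤ.+ k ℤ.* l ℤ.* m) ℤ.* m
    collect = solve-∀

  *-congˡ : ∀ x → y ≅ z [mod m ] → x ℤ.* y ≅ x ℤ.* z [mod m ]
  *-congˡ x y≅z = *-cong (≅-refl {x}) y≅z

  neg-cong : x ≅ y [mod m ] → ℤ.- x ≅ ℤ.- y [mod m ]
  neg-cong {y = y} (mk≅ k refl) = mk≅ (ℤ.- k) (collect y k (+ m))
    where
    collect : ∀ y k m → ℤ.- (y ℤ.+ k ℤ.* m) ≡ ℤ.- y ℤ.+ ℤ.- k ℤ.* m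
    collect = solve-∀

  minus-cong : x ≅ y [mod m ] → z ≅ w [mod m ] → x ℤ.- z ≅ y ℤ.- w [mod m ]
  minus-cong x≅y z≅w = +-cong x≅y (neg-cong z≅w)

  ^-cong : ∀ k → x ≅ y [mod m ] → x ℤ.^ k ≅ y ℤ.^ k [mod m ]
  ^-cong zero    x≅y = ≅-refl
  ^-cong (suc k) x≅y = *-cong x≅y (^-cong k x≅y)

  ^≅1 : ∀ k → x ≅ 1ℤ [mod m ] → x ℤ.^ k ≅ 1ℤ [mod m ]
  ^≅1 k x≅1 = ≅-trans (^-cong k x≅1) (≅-reflexive (ℤ.^-zeroˡ k))

  minus≅0⁻ : x ℤ.- y ≅ 0ℤ [mod m ] → x ≅ y [mod m ]
  minus≅0⁻ {x} {y} (mk≅ k x-y≡) = ∣⇒≅ (ℤ.divides k (trans x-y≡ (ℤ.+-identityˡ _)))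

  minus≅0⁺ : x ≅ y [mod m ] → x ℤ.- y ≅ 0ℤ [mod m ]
  minus≅0⁺ {x} {y} x≅y = ≅-trans (minus-cong x≅y ≅-refl) (≅-reflexive (ℤ.+-inverseʳ y))

  %ℕ-≅ : .{{_ : NonZero m}} → ∀ x → + (x ℤ.%ℕ m) ≅ x [mod m ]
  %ℕ-≅ x = ≅-sym (mk≅ (x ℤ./ℕ m) (ℤ.a≡a%ℕn+[a/ℕn]*n x m))

  %ℕ-injective : .{{_ : NonZero m}} → x ℤ.%ℕ m ≡ y ℤ.%ℕ m → x ≅ y [mod m ]
  %ℕ-injective {x} {y} eq =
    ≅-trans (≅-sym (%ℕ-≅ x)) (≅-trans (≅-reflexive (cong +_ eq)) (%ℕ-≅ y))

_≅?_[mod_] : ∀ x y m → Dec (x ≅ y [mod m ])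
x ≅? y [mod m ] = Dec.map′ ∣⇒≅ ≅⇒∣ (+ m ℤ.∣? x ℤ.- y)

Incongruent : ℕ → List ℤ → Set
Incongruent m = AllPairs (λ x y → ¬ x ≅ y [mod m ])

≅⇒∣∸ : ∀ {m a b} → b ≤ a → + a ≅ + b [mod m ] → m ∣ a ∸ b
≅⇒∣∸ {m} {a} {b} b≤a a≅b =
  subst (m ∣_) (cong ℤ.∣_∣ (trans (ℤ.m-n≡m⊖n a b) (ℤ.⊖-≥ b≤a))) (ℤ.∣⇒∣ᵤ (≅⇒∣ a≅b))

≅⇒≤⇒≡ : ∀ {m a b} → b ≤ a → a < m → + a ≅ + b [mod m ] → a ≡ b
≅⇒≤⇒≡ {m} {a} {b} b≤a a<m a≅b with a ∸ b in eq | ≅⇒∣∸ b≤a a≅b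
... | zero  | _ = ≤-antisym (m∸n≡0⇒m≤n eq) b≤a
... | suc d | m∣ = contradiction (∣⇒≤ m∣) (<⇒≱ (≤-<-trans (subst (_≤ a) eq (m∸n≤m a b)) a<m))

≅⇒≡ : ∀ {m a b} → a < m → b < m → + a ≅ + b [mod m ] → a ≡ b
≅⇒≡ {m} {a} {b} a<m b<m a≅b with ≤-total a b
... | inj₁ a≤b = sym (≅⇒≤⇒≡ a≤b b<m (≅-sym a≅b))
... | inj₂ b≤a = ≅⇒≤⇒≡ b≤a a<m a≅b

module _ {a ℓ} {A : Set a} {R : A → A → Set ℓ} where

  lookup-AllPairs : ∀ {xs} → AllPairs R xs → ∀ {i j} → i Fin.< j → R (lookup xs i) (lookup xs j)
  lookup-AllPairs (x~xs ∷ _) {Fin.zero}  {Fin.suc j} _         = All.lookup x~xs (∈-lookup j)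
  lookup-AllPairs (_ ∷ xs~)  {Fin.suc i} {Fin.suc j} (s≤s i<j) = lookup-AllPairs xs~ i<j

incongruent⇒length≤ : ∀ {m} .{{_ : NonZero m}} {xs} → Incongruent m xs → length xs ≤ m
incongruent⇒length≤ {m} {xs} xs≇ = ≮⇒≥ λ m<len →
  let i , j , i<j , fi≡fj = Fin.pigeonhole m<len residue
  in lookup-AllPairs xs≇ i<j (%ℕ-injective (Fin.fromℕ<-injective _ _ _ _ fi≡fj))
  where
  residue : Fin (length xs) → Fin m
  residue i = Fin.fromℕ< (ℤ.n%ℕd<d (lookup xs i) m)

least : ∀ {ℓ} {P : Pred ℕ ℓ} → Decidable P → ∀ n → P n → ∃[ m ] P m × (∀ {k} → P k → m ≤ k)
least {P = P} P? n Pn = go n Pn (<-wellFounded n)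
  where
  go : ∀ n → P n → Acc _<_ n → ∃[ m ] P m × (∀ {k} → P k → m ≤ k)
  go n Pn (acc rec) with anyUpTo? P? n
  ... | yes (k , k<n , Pk) = go k Pk (rec k<n)
  ... | no ∄k              = n , Pn , λ {k} Pk → ≮⇒≥ λ k<n → ∄k (k , k<n , Pk)

-- Roots of monic polynomials modulo a prime

-- The coefficient list omits the leading coefficient 1.
monic : ∀ {d} → Vec ℤ d → ℤ → ℤ
monic []       x = 1ℤ
monic (c ∷ cs) x = c ℤ.+ x ℤ.* monic cs x

-- Synthetic division by `x - a`: the coefficients of the quotient are the intermediate values of
-- Horner's evaluation at `a`, and its leading coefficient is again the omitted 1.
quot : ∀ {d} → Vec ℤ (suc d) → ℤ → Vec ℤ d
quot (c ∷ [])         a = []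
quot (c ∷ cs@(_ ∷ _)) a = monic cs a ∷ quot cs a

quot-correct : ∀ {d} (cs : Vec ℤ (suc d)) a x →
               monic cs x ℤ.- monic cs a ≡ (x ℤ.- a) ℤ.* monic (quot cs a) x
quot-correct (c ∷ []) a x = identity c a x
  where
  identity : ∀ c a x → c ℤ.+ x ℤ.* 1ℤ ℤ.- (c ℤ.+ a ℤ.* 1ℤ) ≡ (x ℤ.- a) ℤ.* 1ℤ
  identity = solve-∀
quot-correct (c ∷ cs@(_ ∷ _)) a x = begin
  c ℤ.+ x ℤ.* f x ℤ.- (c ℤ.+ a ℤ.* f a)           ≡⟨ before c x a (f x) (f a) ⟩
  (x ℤ.- a) ℤ.* f a ℤ.+ x ℤ.* (f x ℤ.- f a)       ≡⟨ cong (λ t → (x ℤ.- a) ℤ.* f a ℤ.+ x ℤ.* t) (quot-correct cs a x) ⟩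
  (x ℤ.- a) ℤ.* f a ℤ.+ x ℤ.* ((x ℤ.- a) ℤ.* q x) ≡⟨ after x a (f a) (q x) ⟩
  (x ℤ.- a) ℤ.* (f a ℤ.+ x ℤ.* q x)               ∎
  where
  open ≡-Reasoning
  f q : ℤ → ℤ
  f = monic cs
  q = monic (quot cs a)
  before : ∀ c x a fx fa → c ℤ.+ x ℤ.* fx ℤ.- (c ℤ.+ a ℤ.* fa) ≡ (x ℤ.- a) ℤ.* fa ℤ.+ x ℤ.* (fx ℤ.- fa)
  before = solve-∀
  after : ∀ x a fa qx → (x ℤ.- a) ℤ.* fa ℤ.+ x ℤ.* ((x ℤ.- a) ℤ.* qx) ≡ (x ℤ.- a) ℤ.* (fa ℤ.+ x ℤ.* qx)
  after = solve-∀

monic-replicate-0 : ∀ d x → monic (replicate d 0ℤ) x ≡ x ℤ.^ d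
monic-replicate-0 zero    x = refl
monic-replicate-0 (suc d) x = trans (ℤ.+-identityˡ _) (cong (x ℤ.*_) (monic-replicate-0 d x))

module _ {p : ℕ} (p-prime : Prime p) where

  private
    instance
      p≢0 : NonZero p
      p≢0 = prime⇒nonZero p-prime

  1<p : 1 < p
  1<p = nonTrivial⇒n>1 p {{prime⇒nonTrivial p-prime}}
    where open Data.Nat using (nonTrivial⇒n>1)

  *≅0 : ∀ {x y} → x ℤ.* y ≅ 0ℤ [mod p ] → x ≅ 0ℤ [mod p ] ⊎ y ≅ 0ℤ [mod p ]
  *≅0 {x} {y} xy≅0 =
    Sum.map to to (euclidsLemma _ _ p-prime (subst (p ∣_) (ℤ.abs-* x y) (from xy≅0)))
    where
    to : ∀ {z} → p ∣ ℤ.∣ z ∣ → z ≅ 0ℤ [mod p ]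
    to {z} p∣z = ∣⇒≅ (subst (+ p ℤ.∣_) (sym (ℤ.+-identityʳ z)) (ℤ.∣ᵤ⇒∣ p∣z))
    from : ∀ {z} → z ≅ 0ℤ [mod p ] → p ∣ ℤ.∣ z ∣
    from {z} z≅0 = ℤ.∣⇒∣ᵤ (subst (+ p ℤ.∣_) (ℤ.+-identityʳ z) (≅⇒∣ z≅0))

  1≇0 : ¬ 1ℤ ≅ 0ℤ [mod p ]
  1≇0 1≅0 = contradiction (≅⇒≡ 1<p (>-nonZero⁻¹ p) 1≅0) λ ()

  *-cancel : ∀ {x y z} → ¬ x ≅ 0ℤ [mod p ] → x ℤ.* y ≅ x ℤ.* z [mod p ] → y ≅ z [mod p ]
  *-cancel {x} {y} {z} x≇0 xy≅xz
    with *≅0 (≅-trans (≅-reflexive (distrib x y z)) (minus≅0⁺ xy≅xz))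
    where
    distrib : ∀ x y z → x ℤ.* (y ℤ.- z) ≡ x ℤ.* y ℤ.- x ℤ.* z
    distrib = solve-∀
  ... | inj₁ x≅0   = contradiction x≅0 x≇0
  ... | inj₂ y-z≅0 = minus≅0⁻ y-z≅0

  ^≇0 : ∀ {x} → ¬ x ≅ 0ℤ [mod p ] → ∀ k → ¬ x ℤ.^ k ≅ 0ℤ [mod p ]
  ^≇0 x≇0 zero    1≅0 = 1≇0 1≅0
  ^≇0 x≇0 (suc k) xxᵏ≅0 with *≅0 xxᵏ≅0
  ... | inj₁ x≅0  = x≇0 x≅0
  ... | inj₂ xᵏ≅0 = ^≇0 x≇0 k xᵏ≅0

  -- Lagrange's bound. For roots `a` and `x`, the product of `x - a` and the quotient at `x`
  -- vanishes modulo `p`; as `p` is prime and `x` is incongruent to `a`, the quotient vanishes at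
  -- `x`.
  length-roots≤degree : ∀ {d} (cs : Vec ℤ d) {xs} → Incongruent p xs →
                        All (λ x → monic cs x ≅ 0ℤ [mod p ]) xs → length xs ≤ d
  length-roots≤degree cs       []            []          = z≤n
  length-roots≤degree []       (_ ∷ _)       (1≅0 ∷ _)   = contradiction 1≅0 1≇0
  length-roots≤degree cs@(_ ∷ _) {a ∷ _} (a≇xs ∷ xs≇) (fa≅0 ∷ fxs≅0) =
    s≤s (length-roots≤degree (quot cs a) xs≇ (All.zipWith root (a≇xs , fxs≅0)))
    where
    root : ∀ {x} → ¬ a ≅ x [mod p ] × monic cs x ≅ 0ℤ [mod p ] → monic (quot cs a) x ≅ 0ℤ [mod p ]
    root {x} (a≇x , fx≅0)
      with *≅0 (≅-trans (≅-reflexive (sym (quot-correct cs a x))) (minus-cong fx≅0 fa≅0))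
    ... | inj₁ x-a≅0 = contradiction (≅-sym (minus≅0⁻ x-a≅0)) a≇x
    ... | inj₂ qx≅0  = qx≅0

  length-unity-roots≤ : ∀ d .{{_ : NonZero d}} {xs} → Incongruent p xs →
                        All (λ x → x ℤ.^ d ≅ 1ℤ [mod p ]) xs → length xs ≤ d
  length-unity-roots≤ (suc d) xs≇ xsᵈ≅1 =
    -- The list encodes the polynomial `x ^ suc d - 1`.
    length-roots≤degree (-1ℤ ∷ replicate d 0ℤ) xs≇ (All.map (λ {x} → root {x}) xsᵈ≅1)
    where
    root : ∀ {x} → x ℤ.^ suc d ≅ 1ℤ [mod p ] → -1ℤ ℤ.+ x ℤ.* monic (replicate d 0ℤ) x ≅ 0ℤ [mod p ]
    root {x} xᵈ≅1 rewrite monic-replicate-0 d x = +-cong (≅-refl {x = -1ℤ}) xᵈ≅1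

-- Prime powers and multiplicative orders

^-distrib-* : ∀ x y k → (x ℤ.* y) ℤ.^ k ≡ x ℤ.^ k ℤ.* y ℤ.^ k
^-distrib-* x y zero    = refl
^-distrib-* x y (suc k) = trans (cong (x ℤ.* y ℤ.*_) (^-distrib-* x y k)) (interchange x y (x ℤ.^ k) (y ℤ.^ k))
  where
  interchange : ∀ a b c d → a ℤ.* b ℤ.* (c ℤ.* d) ≡ a ℤ.* c ℤ.* (b ℤ.* d)
  interchange = solve-∀

coprime-^ : ∀ {q m} → Prime q → ¬ q ∣ m → ∀ k → Coprime (q ^ k) m
coprime-^ {q} {m} q-prime q∤m zero    (d∣1 , _) = ∣1⇒≡1 d∣1
coprime-^ {q} {m} q-prime q∤m (suc k) {d} (d∣qqᵏ , d∣m) =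
  coprime-^ q-prime q∤m k (Coprime.coprime-divisor d⊥q d∣qqᵏ , d∣m)
  where
  d⊥q : Coprime d q
  d⊥q {e} (e∣d , e∣q) with prime⇒irreducible q-prime e∣q
  ... | inj₁ e≡1  = e≡1
  ... | inj₂ refl = contradiction (∣-trans e∣d d∣m) q∤m

abstract

  split-power : ∀ {q} → Prime q → ∀ m .{{_ : NonZero m}} → ∃[ t ] ∃[ m′ ] m ≡ q ^ t * m′ × ¬ q ∣ m′
  split-power {q} q-prime m = go m (<-wellFounded m)
    where
    instance
      q>1 : NonTrivial q
      q>1 = prime⇒nonTrivial q-prime
    go : ∀ m .{{_ : NonZero m}} → Acc _<_ m → ∃[ t ] ∃[ m′ ] m ≡ q ^ t * m′ × ¬ q ∣ m′
    go m (acc rec) with q ∣? m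
    ... | no q∤m = 0 , m , sym (*-identityˡ m) , q∤m
    ... | yes q∣m@(divides n m≡nq) =
      let instance n≢0 = m*n≢0⇒m≢0 n {{subst NonZero m≡nq it}}
          t , m′ , n≡ , q∤m′ = go n (rec (subst (n <_) (sym m≡nq) (m<m*n n q (nonTrivial⇒n>1 q))))
      in suc t , m′ , trans m≡nq (trans (*-comm n q) (trans (cong (q *_) n≡) (sym (*-assoc q _ m′)))) , q∤m′

  primeDivisor : ∀ m .{{_ : NonZero m}} → m ≢ 1 → ∃[ q ] Prime q × q ∣ m
  primeDivisor m m≢1 with factorise m
  ... | record { factors = []     ; isFactorisation = m≡1 } = contradiction m≡1 m≢1
  ... | record { factors = q ∷ qs ; isFactorisation = m≡ ; factorsPrime = q-prime ∷ _ } =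
    q , q-prime , divides (product qs) (trans m≡ (*-comm q (product qs)))

  -- Since `n` does not divide `m`, the cofactor of `n` over the gcd `c` is not 1 and has a prime
  -- factor `q`. With `q ^ t` the exact power of `q` in `c`, it is also the exact power in `m`: if
  -- `q` divided both cofactors, `c * q` would be a common divisor exceeding `c`.
  prime-excess : ∀ {m n} → 0 < m → 0 < n → ¬ n ∣ m →
                 ∃[ q ] ∃[ t ] ∃[ m′ ] ∃[ n′ ] Prime q × m ≡ m′ * q ^ t × n ≡ q ^ suc t * n′ × ¬ q ∣ m′
  prime-excess {m} {n} 0<m 0<n n∤m = go (gcd m n) (gcd[m,n]∣m m n) (gcd[m,n]∣n m n) gcd-greatest
    where
    go : ∀ c → c ∣ m → c ∣ n → (∀ {d} → d ∣ m → d ∣ n → d ∣ c) →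
         ∃[ q ] ∃[ t ] ∃[ m′ ] ∃[ n′ ] Prime q × m ≡ m′ * q ^ t × n ≡ q ^ suc t * n′ × ¬ q ∣ m′
    go c c∣m@(divides f m≡fc) (divides e n≡ec) greatest =
      let q , q-prime , q∣e@(divides e′ e≡e′q) = primeDivisor e e≢1
          t , c′ , c≡ , q∤c′ = split-power q-prime c
      in q , t , c′ * f , e′ * c′ , q-prime ,
         trans m≡fc (trans (cong (f *_) c≡) (regroup-m f (q ^ t) c′)) ,
         trans n≡ec (trans (cong₂ _*_ e≡e′q c≡) (regroup-n e′ q (q ^ t) c′)) ,
         λ q∣c′f → Sum.[ q∤c′ , q∤f q-prime q∣e ] (euclidsLemma c′ f q-prime q∣c′f)
      where
      instance
        c≢0 : NonZero c
        c≢0 = m*n≢0⇒n≢0 f {{subst NonZero m≡fc (>-nonZero 0<m)}}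
        e≢0 : NonZero e
        e≢0 = m*n≢0⇒m≢0 e {{subst NonZero n≡ec (>-nonZero 0<n)}}
      e≢1 : e ≢ 1
      e≢1 refl = n∤m (subst (_∣ m) (sym (trans n≡ec (+-identityʳ c))) c∣m)
      q∤f : ∀ {q} → Prime q → q ∣ e → ¬ q ∣ f
      q∤f {q} q-prime q∣e q∣f = <⇒≱ (m<m*n c q (nonTrivial⇒n>1 q {{prime⇒nonTrivial q-prime}}))
        (∣⇒≤ (greatest (cq∣ m≡fc q∣f) (cq∣ n≡ec q∣e)))
        where
        cq∣ : ∀ {d k} → k ≡ d * c → q ∣ d → c * q ∣ k
        cq∣ {d} refl q∣d = subst (_∣ d * c) (*-comm q c) (*-monoˡ-∣ c q∣d)
      regroup-m : ∀ f u c → f * (u * c) ≡ c * f * u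
      regroup-m = ℕ.solve-∀
      regroup-n : ∀ e q u c → e * q * (u * c) ≡ q * u * (e * c)
      regroup-n = ℕ.solve-∀

record HasOrder (p : ℕ) (x : ℤ) (m : ℕ) : Set where
  field
    positive : 0 < m
    ^order   : x ℤ.^ m ≅ 1ℤ [mod p ]
    divides! : ∀ k → x ℤ.^ k ≅ 1ℤ [mod p ] → m ∣ k

open HasOrder

HasOrder-^ : ∀ {p x} a b → HasOrder p x (a * b) → HasOrder p (x ℤ.^ b) a
HasOrder-^ {p} {x} a b ord = record
  { positive = >-nonZero⁻¹ a {{m*n≢0⇒m≢0 a {{ab≢0}}}}
  ; ^order   = subst (_≅ 1ℤ [mod p ]) (trans (cong (x ℤ.^_) (*-comm a b)) (sym (ℤ.^-*-assoc x b a))) (^order ord)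
  ; divides! = λ k xᵇᵏ≅1 → *-cancelˡ-∣ b (subst (_∣ b * k) (*-comm a b)
                 (divides! ord (b * k) (subst (_≅ 1ℤ [mod p ]) (ℤ.^-*-assoc x b k) xᵇᵏ≅1)))
  }
  where
  instance
    ab≢0 : NonZero (a * b)
    ab≢0 = >-nonZero (positive ord)
    b≢0 : NonZero b
    b≢0 = m*n≢0⇒n≢0 a

-- If the `k`-th power of the product is 1, raising it to the power `b` removes `y`, so `a` divides
-- `k * b` and by coprimality `k`. The same holds for `b` by symmetry, and coprime divisors of `k`
-- multiply.
HasOrder-* : ∀ {p x y a b} → Coprime a b → HasOrder p x a → HasOrder p y b → HasOrder p (x ℤ.* y) (a * b)
HasOrder-* {p} {x} {y} {a} {b} a⊥b ordx ordy = record
  { positive = *-mono-≤ (positive ordx) (positive ordy)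
  ; ^order   = ≅-trans (≅-reflexive (^-distrib-* x y (a * b)))
                 (*-cong (≅1 a b x (^order ordx)) (subst (λ c → y ℤ.^ c ≅ 1ℤ [mod p ]) (*-comm b a) (≅1 b a y (^order ordy))))
  ; divides! = λ k xyᵏ≅1 → coprime-*∣ (∣ˡ k xyᵏ≅1) (∣ʳ k xyᵏ≅1)
  }
  where
  ≅1 : ∀ a b x → x ℤ.^ a ≅ 1ℤ [mod p ] → x ℤ.^ (a * b) ≅ 1ℤ [mod p ]
  ≅1 a b x xᵃ≅1 = subst (_≅ 1ℤ [mod p ]) (ℤ.^-*-assoc x a b) (^≅1 b xᵃ≅1)

  coprime-*∣ : ∀ {k} → a ∣ k → b ∣ k → a * b ∣ k
  coprime-*∣ {k} a∣k@(divides c refl) b∣k =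
    subst (_∣ c * a) (*-comm b a) (*-monoˡ-∣ a (Coprime.coprime-divisor (Coprime.sym a⊥b) (subst (b ∣_) (*-comm c a) b∣k)))

  eliminate : ∀ {x y a b} → Coprime a b → HasOrder p x a → HasOrder p y b →
              ∀ k → (x ℤ.* y) ℤ.^ k ≅ 1ℤ [mod p ] → a ∣ k
  eliminate {x} {y} {a} {b} a⊥b ordx ordy k xyᵏ≅1 =
    Coprime.coprime-divisor a⊥b (divides! ordx (b * k) (subst (λ c → x ℤ.^ c ≅ 1ℤ [mod p ]) (*-comm k b) xᵏᵇ≅1))
    where
    yᵏᵇ≅1 : y ℤ.^ (k * b) ≅ 1ℤ [mod p ]
    yᵏᵇ≅1 = subst (λ c → y ℤ.^ c ≅ 1ℤ [mod p ]) (*-comm b k) (≅1 b k y (^order ordy))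
    xᵏᵇ≅1 : x ℤ.^ (k * b) ≅ 1ℤ [mod p ]
    xᵏᵇ≅1 = ≅-trans (≅-reflexive (sym (ℤ.*-identityʳ _)))
           (≅-trans (*-congˡ (x ℤ.^ (k * b)) (≅-sym yᵏᵇ≅1))
           (≅-trans (≅-reflexive (sym (^-distrib-* x y (k * b)))) (≅1 k b (x ℤ.* y) xyᵏ≅1)))

  ∣ˡ : ∀ k → (x ℤ.* y) ℤ.^ k ≅ 1ℤ [mod p ] → a ∣ k
  ∣ˡ = eliminate a⊥b ordx ordy

  ∣ʳ : ∀ k → (x ℤ.* y) ℤ.^ k ≅ 1ℤ [mod p ] → b ∣ k
  ∣ʳ k = eliminate (Coprime.sym a⊥b) ordy ordx k ∘ subst (λ z → z ℤ.^ k ≅ 1ℤ [mod p ]) (ℤ.*-comm x y)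

-- Existence of primitive roots modulo a prime

module _ {p : ℕ} (p-prime : Prime p) where

  private
    instance
      p≢0′ : NonZero p
      p≢0′ = prime⇒nonZero p-prime

  ^-cancel : ∀ {x} → ¬ x ≅ 0ℤ [mod p ] → ∀ {i j} → i ≤ j → x ℤ.^ i ≅ x ℤ.^ j [mod p ] →
             x ℤ.^ (j ∸ i) ≅ 1ℤ [mod p ]
  ^-cancel {x} x≇0 {i} {j} i≤j xⁱ≅xʲ = *-cancel p-prime (^≇0 p-prime x≇0 i)
    (≅-trans (≅-reflexive (trans (sym (ℤ.^-distribˡ-+-* x i (j ∸ i))) (cong (x ℤ.^_) (m+[n∸m]≡n i≤j))))
    (≅-trans (≅-sym xⁱ≅xʲ) (≅-reflexive (sym (ℤ.*-identityʳ _)))))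

  abstract

    -- Among the `suc p` powers with exponents 0 to `p` two agree modulo `p`, and cancelling gives a
    -- positive exponent with power 1. The least such exponent divides every other, as a nonzero
    -- remainder would be a smaller one.
    unit⇒HasOrder : ∀ {x} → ¬ x ≅ 0ℤ [mod p ] → ∃[ m ] HasOrder p x m
    unit⇒HasOrder {x} x≇0 =
      let i , j , i<j , fi≡fj = Fin.pigeonhole (n<1+n p) residue
          m , (0<m , xᵐ≅1) , minimal = least (λ k → 0 <? k ×-dec x ℤ.^ k ≅? 1ℤ [mod p ]) (toℕ j ∸ toℕ i)
            (m<n⇒0<n∸m i<j , ^-cancel x≇0 (<⇒≤ i<j) (%ℕ-injective (Fin.fromℕ<-injective _ _ _ _ fi≡fj)))
      in m , record
        { positive = 0<m
        ; ^order   = xᵐ≅1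
        ; divides! = λ k xᵏ≅1 → m%n≡0⇒n∣m k m {{>-nonZero 0<m}} (remainder m 0<m xᵐ≅1 minimal k xᵏ≅1)
        }
      where
      residue : Fin (suc p) → Fin p
      residue i = Fin.fromℕ< (ℤ.n%ℕd<d (x ℤ.^ toℕ i) p)

      remainder : ∀ m (0<m : 0 < m) → x ℤ.^ m ≅ 1ℤ [mod p ] →
                  (∀ {k} → 0 < k × x ℤ.^ k ≅ 1ℤ [mod p ] → m ≤ k) →
                  ∀ k → x ℤ.^ k ≅ 1ℤ [mod p ] → _%_ k m {{>-nonZero 0<m}} ≡ 0
      remainder m 0<m xᵐ≅1 minimal k xᵏ≅1 with _%_ k m {{>-nonZero 0<m}} in eq
      ... | zero  = refl
      ... | suc r = contradiction (minimal (z<s , xʳ≅1)) (<⇒≱ (subst (_< m) eq (m%n<n k m)))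
        where
        instance
          m≢0 : NonZero m
          m≢0 = >-nonZero 0<m
        xʳ≅1 : x ℤ.^ suc r ≅ 1ℤ [mod p ]
        xʳ≅1 = ≅-trans (≅-reflexive (sym (ℤ.*-identityʳ _)))
              (≅-trans (*-congˡ (x ℤ.^ suc r) (≅-sym (^≅1 (k / m) xᵐ≅1)))
              (≅-trans (≅-reflexive (trans (cong (x ℤ.^ suc r ℤ.*_) (ℤ.^-*-assoc x m (k / m)))
                (trans (sym (ℤ.^-distribˡ-+-* x (suc r) (m * (k / m))))
                  (cong (x ℤ.^_) (sym (trans (m≡m%n+[m/n]*n k m) (cong₂ _+_ eq (*-comm (k / m) m)))))))) xᵏ≅1))

  powers-incongruent : ∀ {x m} → HasOrder p x m → ¬ x ≅ 0ℤ [mod p ] → ∀ {i j} → i < j → j < m →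
                       ¬ x ℤ.^ i ≅ x ℤ.^ j [mod p ]
  powers-incongruent {x} {m} ord x≇0 {i} {j} i<j j<m xⁱ≅xʲ =
    <⇒≱ (≤-<-trans (m∸n≤m j i) j<m)
      (∣⇒≤ {{>-nonZero (m<n⇒0<n∸m i<j)}} (divides! ord (j ∸ i) (^-cancel x≇0 (<⇒≤ i<j) xⁱ≅xʲ)))

  order⇒unit : ∀ {x m} → HasOrder p x m → ¬ x ≅ 0ℤ [mod p ]
  order⇒unit {x} {suc m} ord x≅0 = 1≇0 p-prime (≅-trans (≅-sym (^order ord)) (*-cong x≅0 ≅-refl))
  order⇒unit {m = zero} ord with () ← positive ord

  order<p : ∀ {x m} → HasOrder p x m → m < p
  order<p {x} {m} ord = subst (_≤ p) (cong suc (trans (length-map (x ℤ.^_) (upTo m)) (length-upTo m)))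
    -- The residue 0 is added to the `m` distinct powers, none of which vanishes; it turns `m ≤ p`
    -- into `m < p`.
    (incongruent⇒length≤ {xs = 0ℤ ∷ map (x ℤ.^_) (upTo m)}
      (All.map⁺ (All.applyUpTo⁺₂ _ m λ i → ^≇0 p-prime x≇0 i ∘ ≅-sym) ∷
       AllPairs.map⁺ (AllPairs.applyUpTo⁺₁ _ m (powers-incongruent ord x≇0))))
    where
    x≇0 = order⇒unit ord

  -- The order `n` of `y` does not divide `m`, so some prime `q` occurs in `n` to a power higher
  -- than its exact power `q ^ t` in `m`. Removing `q` from the order of `x`, and everything but
  -- `q ^ suc t` from that of `y`, leaves coprime orders whose product is `m * q`.
  raise-order : ∀ {x m y} → HasOrder p x m → ¬ y ≅ 0ℤ [mod p ] → ¬ y ℤ.^ m ≅ 1ℤ [mod p ] →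
                ∃[ x′ ] ∃[ m′ ] m < m′ × HasOrder p x′ m′
  raise-order {x} {m} {y} ordx y≇0 yᵐ≇1 = raise (unit⇒HasOrder y≇0)
    where
    raise : ∃[ n ] HasOrder p y n → ∃[ x′ ] ∃[ m′ ] m < m′ × HasOrder p x′ m′
    raise (n , ordy) with prime-excess (positive ordx) (positive ordy) n∤m
      where
      n∤m : ¬ n ∣ m
      n∤m (divides k refl) = yᵐ≇1 (subst (_≅ 1ℤ [mod p ])
        (trans (ℤ.^-*-assoc y n k) (cong (y ℤ.^_) (*-comm n k))) (^≅1 k (^order ordy)))
    ... | q , t , m′ , n′ , q-prime , m≡ , n≡ , q∤m′ =
      x ℤ.^ (q ^ t) ℤ.* y ℤ.^ n′ , m′ * q ^ suc t , bigger ,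
      HasOrder-* (Coprime.sym (coprime-^ q-prime q∤m′ (suc t)))
        (HasOrder-^ m′ (q ^ t) (subst (HasOrder p x) m≡ ordx))
        (HasOrder-^ (q ^ suc t) n′ (subst (HasOrder p y) n≡ ordy))
      where
      bigger : m < m′ * q ^ suc t
      bigger = subst (m <_) (trans (cong (_* q) m≡) (trans (*-assoc m′ (q ^ t) q) (cong (m′ *_) (*-comm (q ^ t) q))))
        (m<m*n m q {{>-nonZero (positive ordx)}} (nonTrivial⇒n>1 q {{prime⇒nonTrivial q-prime}}))

  0<y<p⇒unit : ∀ {y} → 0 < y → y < p → ¬ + y ≅ 0ℤ [mod p ]
  0<y<p⇒unit 0<y y<p y≅0 = <⇒≢ 0<y (sym (≅⇒≡ y<p (>-nonZero⁻¹ p) y≅0))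

  -- Starting from the element 1, the order `m` is raised while some unit has `m`-th power other
  -- than 1; orders stay below `p`, so this stops. Then all `p ∸ 1` units are roots of `x ^ m - 1`,
  -- which forces `p ∸ 1 ≤ m`.
  primitive-root : ∃[ θ ] HasOrder p θ (p ∸ 1)
  primitive-root = let m , ord = unit⇒HasOrder (1≇0 p-prime) in go ord (<-wellFounded (p ∸ m))
    where
    go : ∀ {x m} → HasOrder p x m → Acc _<_ (p ∸ m) → ∃[ θ ] HasOrder p θ (p ∸ 1)
    go {x} {m} ord (acc rec) with anyUpTo? (λ y → 0 <? y ×-dec ¬? ((+ y) ℤ.^ m ≅? 1ℤ [mod p ])) p
    ... | yes (y , y<p , 0<y , yᵐ≇1) =
      let x′ , m′ , m<m′ , ord′ = raise-order ord (0<y<p⇒unit 0<y y<p) yᵐ≇1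
      in go ord′ (rec (∸-monoʳ-< m<m′ (<⇒≤ (order<p ord′))))
    ... | no ∄y = x , subst (HasOrder p x) (≤-antisym (∸-monoˡ-≤ 1 (order<p ord)) p∸1≤m) ord
      where
      units : List ℤ
      units = List.applyUpTo (λ i → + suc i) (p ∸ 1)
      suc< : ∀ {i} → i < p ∸ 1 → suc i < p
      suc< i<p∸1 = ≤-trans (s≤s i<p∸1) (≤-reflexive (m+[n∸m]≡n (>-nonZero⁻¹ p)))
      p∸1≤m : p ∸ 1 ≤ m
      p∸1≤m = subst (_≤ m) (length-applyUpTo _ (p ∸ 1)) (length-unity-roots≤ p-prime m {{>-nonZero (positive ord)}} {units}
        (AllPairs.applyUpTo⁺₁ _ (p ∸ 1) λ i<j j<p∸1 i≅j →
          <⇒≢ i<j (suc-injective (≅⇒≡ (<-trans (s≤s i<j) (suc< j<p∸1)) (suc< j<p∸1) i≅j)))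
        (All.applyUpTo⁺₁ _ (p ∸ 1) λ {i} i<p∸1 →
          Dec.decidable-stable (_ ≅? _ [mod p ]) λ yᵐ≇1 → ∄y (suc i , suc< i<p∸1 , z<s , yᵐ≇1)))

≅-weaken : ∀ {m n x y} → m ∣ n → x ≅ y [mod n ] → x ≅ y [mod m ]
≅-weaken {m} {y = y} (divides c refl) (mk≅ k x≡) =
  mk≅ (k ℤ.* + c) (trans x≡ (cong (ℤ._+_ y) (trans (cong (k ℤ.*_) (ℤ.pos-* c m)) (sym (ℤ.*-assoc k (+ c) (+ m))))))

module _ {a p ℓ} {A : Set a} {P : Pred A p} {R : A → A → Set ℓ} where

  AllPairs-All : ∀ {xs} → All P xs → AllPairs R xs → AllPairs (λ x y → P x × P y × R x y) xs
  AllPairs-All []         []           = []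
  AllPairs-All (px ∷ pxs) (rx ∷ rxs) = All.zipWith (λ (py , r) → px , py , r) (pxs , rx) ∷ AllPairs-All pxs rxs

-- Sidon sets modulo N

-- The premise `a ≢ b` excludes the trivial solutions of difference 0. Nothing is assumed of `c` and
-- `d`: the choice `c = d = a` shows that distinct elements are incongruent modulo `N`.
SidonMod : ℕ → List ℤ → Set
SidonMod N X = ∀ {a b c d} → a ∈ X → b ∈ X → c ∈ X → d ∈ X → a ≢ b →
               a ℤ.- b ≅ c ℤ.- d [mod N ] → a ≡ c × b ≡ d

SidonMod-⊆ : ∀ {N X Y} → All (_∈ X) Y → SidonMod N X → SidonMod N Y
SidonMod-⊆ Y⊆X sidon a∈ b∈ c∈ d∈ =
  sidon (All.lookup Y⊆X a∈) (All.lookup Y⊆X b∈) (All.lookup Y⊆X c∈) (All.lookup Y⊆X d∈)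

HasOrder-^-cong : ∀ {p x m} → HasOrder p x m → ∀ {i j} → + i ≅ + j [mod m ] → x ℤ.^ i ≅ x ℤ.^ j [mod p ]
HasOrder-^-cong {p} {x} {m} ord {i} {j} i≅j =
  Sum.[ (λ i≤j → ≅-sym (ordered i≤j (≅-sym i≅j))) , (λ j≤i → ordered j≤i i≅j) ]′ (≤-total i j)
  where
  ordered : ∀ {i j} → i ≤ j → + j ≅ + i [mod m ] → x ℤ.^ j ≅ x ℤ.^ i [mod p ]
  ordered {i} {j} i≤j j≅i with divides k j∸i≡km ← ≅⇒∣∸ i≤j j≅i =
    ≅-trans (≅-reflexive (trans (cong (x ℤ.^_) (trans (sym (m+[n∸m]≡n i≤j)) (cong (_+_ i) (trans j∸i≡km (*-comm k m)))))
      (trans (ℤ.^-distribˡ-+-* x i (m * k)) (cong (x ℤ.^ i ℤ.*_) (sym (ℤ.^-*-assoc x m k))))))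
    (≅-trans (*-congˡ (x ℤ.^ i) (^≅1 k (HasOrder.^order ord))) (≅-reflexive (ℤ.*-identityʳ _)))

≅+-cancelʳ : ∀ {m x y z} → x ℤ.+ z ≅ y ℤ.+ z [mod m ] → x ≅ y [mod m ]
≅+-cancelʳ {x = x} {y} {z} x+z≅y+z = ≅-trans (≅-reflexive (regroup x z))
  (≅-trans (minus-cong {x = x ℤ.+ z} {y = y ℤ.+ z} x+z≅y+z (≅-refl {x = z})) (≅-reflexive (sym (regroup y z))))
  where
  regroup : ∀ x z → x ≡ x ℤ.+ z ℤ.- z
  regroup = solve-∀

minus-move : ∀ {m i j k l} → + i ℤ.- + j ≅ + k ℤ.- + l [mod m ] → + (i + l) ≅ + (k + j) [mod m ]
minus-move {m} {i} {j} {k} {l} i-j≅k-l = subst₂ (_≅_[mod m ]) (trans (before (+ i) (+ j) (+ l)) (sym (ℤ.pos-+ i l)))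
  (trans (after (+ k) (+ j) (+ l)) (sym (ℤ.pos-+ k j)))
  (+-cong {x = + i ℤ.- + j} {y = + k ℤ.- + l} i-j≅k-l (≅-refl {x = + j ℤ.+ + l}))
  where
  before : ∀ i j l → i ℤ.- j ℤ.+ (j ℤ.+ l) ≡ i ℤ.+ l
  before = solve-∀
  after : ∀ k j l → k ℤ.- l ℤ.+ (j ℤ.+ l) ≡ k ℤ.+ j
  after = solve-∀

-- The product equals `A D - B D - B (A - B)`, which the two congruences turn into
-- `C B - B D - B (C - D) = 0`.
cross-difference≅0 : ∀ {m A B C D} → A ℤ.- B ≅ C ℤ.- D [mod m ] → A ℤ.* D ≅ C ℤ.* B [mod m ] →
               (A ℤ.- B) ℤ.* (D ℤ.- B) ≅ 0ℤ [mod m ]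
cross-difference≅0 {m} {A} {B} {C} {D} (mk≅ k A-B≡) (mk≅ l AD≡) = mk≅ (l ℤ.- B ℤ.* k) (begin
  (A ℤ.- B) ℤ.* (D ℤ.- B)                                             ≡⟨ expand A B D ⟩
  A ℤ.* D ℤ.- B ℤ.* D ℤ.- B ℤ.* (A ℤ.- B)                             ≡⟨ cong₂ (λ s t → s ℤ.- B ℤ.* D ℤ.- B ℤ.* t) AD≡ A-B≡ ⟩
  C ℤ.* B ℤ.+ l ℤ.* + m ℤ.- B ℤ.* D ℤ.- B ℤ.* (C ℤ.- D ℤ.+ k ℤ.* + m) ≡⟨ collect B C D k l (+ m) ⟩
  0ℤ ℤ.+ (l ℤ.- B ℤ.* k) ℤ.* + m                                      ∎)
  where
  open ≡-Reasoning
  expand : ∀ A B D → (A ℤ.- B) ℤ.* (D ℤ.- B) ≡ A ℤ.* D ℤ.- B ℤ.* D ℤ.- B ℤ.* (A ℤ.- B)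
  expand = solve-∀
  collect : ∀ B C D k l m →
    C ℤ.* B ℤ.+ l ℤ.* m ℤ.- B ℤ.* D ℤ.- B ℤ.* (C ℤ.- D ℤ.+ k ℤ.* m) ≡ 0ℤ ℤ.+ (l ℤ.- B ℤ.* k) ℤ.* m
  collect = solve-∀

-- Ruzsa's Sidon set

module Ruzsa {q : ℕ} (p-prime : Prime (suc q)) {θ : ℤ} (θ-primitive : HasOrder (suc q) θ q) where

  abstract

    -- The Chinese remainder representative of i modulo q and θ ^ i modulo suc q.
    element : ℕ → ℤ
    element i = + suc q ℤ.* + i ℤ.- + q ℤ.* θ ℤ.^ i

    -- Here `suc q` is 1 modulo `q`; for the other modulus, `- q` is 1 modulo `suc q`.
    element-mod-q : ∀ i → element i ≅ + i [mod q ]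
    element-mod-q i = mk≅ (+ i ℤ.- θ ℤ.^ i) (identity (+ q) (+ i) (θ ℤ.^ i))
      where
      identity : ∀ q i t → (1ℤ ℤ.+ q) ℤ.* i ℤ.- q ℤ.* t ≡ i ℤ.+ (i ℤ.- t) ℤ.* q
      identity = solve-∀

    element-mod-p : ∀ i → element i ≅ θ ℤ.^ i [mod suc q ]
    element-mod-p i = mk≅ (+ i ℤ.- θ ℤ.^ i) (identity (+ q) (+ i) (θ ℤ.^ i))
      where
      identity : ∀ q i t → (1ℤ ℤ.+ q) ℤ.* i ℤ.- q ℤ.* t ≡ t ℤ.+ (i ℤ.- t) ℤ.* (1ℤ ℤ.+ q)
      identity = solve-∀

  power-injective : ∀ {i j} → i < q → j < q → θ ℤ.^ i ≅ θ ℤ.^ j [mod suc q ] → i ≡ j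
  power-injective {i} {j} i<q j<q θⁱ≅θʲ with <-cmp i j
  ... | tri< i<j _ _ = contradiction θⁱ≅θʲ (powers-incongruent p-prime θ-primitive (order⇒unit p-prime θ-primitive) i<j j<q)
  ... | tri≈ _ i≡j _ = i≡j
  ... | tri> _ _ j<i = contradiction (≅-sym θⁱ≅θʲ) (powers-incongruent p-prime θ-primitive (order⇒unit p-prime θ-primitive) j<i i<q)

  element-sidon : ∀ {i j k l} → i < q → j < q → k < q → l < q → i ≢ j →
                  element i ℤ.- element j ≅ element k ℤ.- element l [mod suc q * q ] → i ≡ k × j ≡ l
  element-sidon {i} {j} {k} {l} i<q j<q k<q l<q i≢j eq = conclude (*≅0 p-prime product≅0)
    where
    A B C D : ℤ
    A = θ ℤ.^ i
    B = θ ℤ.^ j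
    C = θ ℤ.^ k
    D = θ ℤ.^ l

    differences : A ℤ.- B ≅ C ℤ.- D [mod suc q ]
    differences = ≅-trans (≅-sym (minus-cong (element-mod-p i) (element-mod-p j)))
      (≅-trans (≅-weaken (m∣m*n q) eq) (minus-cong (element-mod-p k) (element-mod-p l)))

    indices : + i ℤ.- + j ≅ + k ℤ.- + l [mod q ]
    indices = ≅-trans (≅-sym (minus-cong (element-mod-q i) (element-mod-q j)))
      (≅-trans (≅-weaken (n∣m*n (suc q)) eq) (minus-cong (element-mod-q k) (element-mod-q l)))

    products : A ℤ.* D ≅ C ℤ.* B [mod suc q ]
    products = subst₂ (_≅_[mod suc q ]) (ℤ.^-distribˡ-+-* θ i l) (ℤ.^-distribˡ-+-* θ k j)
      -- Powers of `θ` depend only on the exponent modulo `q`, which is exactly the modulus of the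
      -- index congruence.
      (HasOrder-^-cong θ-primitive {i + l} {k + j} (minus-move {i = i} {j} {k} {l} indices))

    product≅0 : (A ℤ.- B) ℤ.* (D ℤ.- B) ≅ 0ℤ [mod suc q ]
    product≅0 = cross-difference≅0 {A = A} {B} {C} {D} differences products

    conclude : A ℤ.- B ≅ 0ℤ [mod suc q ] ⊎ D ℤ.- B ≅ 0ℤ [mod suc q ] → i ≡ k × j ≡ l
    conclude (inj₁ A-B≅0) = contradiction (power-injective i<q j<q (minus≅0⁻ {x = A} {B} A-B≅0)) i≢j
    conclude (inj₂ D-B≅0) =
      power-injective i<q k<q (≅+-cancelʳ {z = ℤ.- D} (≅-trans (minus-cong (≅-refl {x = A}) D≅B) differences)) ,
      sym (power-injective l<q j<q D≅B)
      where
      D≅B : D ≅ B [mod suc q ]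
      D≅B = minus≅0⁻ {x = D} {B} D-B≅0

  elements : List ℤ
  elements = map element (upTo q)

  elements-unique : Unique elements
  elements-unique = AllPairs.map⁺ (AllPairs.applyUpTo⁺₁ _ q λ {i} {j} i<j j<q eq →
    <⇒≢ i<j (power-injective (<-trans i<j j<q) j<q
      (≅-trans (≅-sym (element-mod-p i)) (≅-trans (≅-reflexive eq) (element-mod-p j)))))

  ∈elements⁻ : ∀ {x} → x ∈ elements → ∃[ i ] i < q × x ≡ element i
  ∈elements⁻ x∈ with i , i∈ , x≡ ← ∈-map⁻ element x∈ = i , ∈-upTo⁻ i∈ , x≡

  elements-sidon : SidonMod (suc q * q) elements
  elements-sidon a∈ b∈ c∈ d∈ = sidon (∈elements⁻ a∈) (∈elements⁻ b∈) (∈elements⁻ c∈) (∈elements⁻ d∈)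
    where
    sidon : ∀ {a b c d} → ∃[ i ] i < q × a ≡ element i → ∃[ j ] j < q × b ≡ element j →
            ∃[ k ] k < q × c ≡ element k → ∃[ l ] l < q × d ≡ element l → a ≢ b →
            a ℤ.- b ≅ c ℤ.- d [mod suc q * q ] → a ≡ c × b ≡ d
    sidon (i , i<q , refl) (j , j<q , refl) (k , k<q , refl) (l , l<q , refl) a≢b eq =
      Product.map (cong element) (cong element) (element-sidon i<q j<q k<q l<q (a≢b ∘ cong element) eq)

-- Reduction modulo M of a Sidon set modulo g * M

-- Members of the class have the form `d + k M`, and congruence of the `k` modulo `g` would make
-- them congruent modulo `g * M`. So the `k` are pairwise incongruent modulo `g`.
class-size≤ : ∀ {g M d} .{{_ : NonZero g}} xs →
              Incongruent (g * M) xs → All (_≅ d [mod M ]) xs → length xs ≤ g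
class-size≤ {g} {M} {d} xs xs≇ xs≅d with quotients xs≅d
  where
  quotients : ∀ {xs} → All (_≅ d [mod M ]) xs → ∃[ ks ] xs ≡ map (λ k → d ℤ.+ k ℤ.* + M) ks
  quotients [] = [] , refl
  quotients (mk≅ k refl ∷ xs≅d) with ks , refl ← quotients xs≅d = k ∷ ks , refl
... | ks , refl = subst (_≤ g) (sym (length-map _ ks))
  (incongruent⇒length≤ (AllPairs.map (λ ≇ → ≇ ∘ scale) (AllPairs.map⁻ xs≇)))
  where
  scale : ∀ {k l} → k ≅ l [mod g ] → d ℤ.+ k ℤ.* + M ≅ d ℤ.+ l ℤ.* + M [mod g * M ]
  scale {l = l} (mk≅ q refl) = mk≅ q (trans (identity d l q (+ g) (+ M))
    (cong (λ t → d ℤ.+ l ℤ.* + M ℤ.+ q ℤ.* t) (sym (ℤ.pos-* g M))))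
    where
    identity : ∀ d l q g M → d ℤ.+ (l ℤ.+ q ℤ.* g) ℤ.* M ≡ d ℤ.+ l ℤ.* M ℤ.+ q ℤ.* (g ℤ.* M)
    identity = solve-∀

infix 4 _∈[mod_]_

_∈[mod_]_ : ℤ → ℕ → List ℤ → Set
u ∈[mod M ] Y = Any (u ≅_[mod M ]) Y

Difference : ℕ → List ℤ → ℤ → ℤ × ℤ → Set
Difference M X d (u , v) = u ∈ X × v ∈ X × u ≢ v × u ℤ.- v ≅ d [mod M ]

-- The form met in rulers and gaps: `u` and `v` need only be congruent to elements of `Y`, and the
-- pair is read as (start , end), opposite to the orientation of `Difference`.
ResidueDifference : ℕ → List ℤ → ℤ → ℤ × ℤ → Set
ResidueDifference M Y d (u , v) = u ∈[mod M ] Y × v ∈[mod M ] Y × ¬ u ≅ v [mod M ] × v ℤ.- u ≅ d [mod M ]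

module _ {g M : ℕ} .{{_ : NonZero g}} where

  -- By the Sidon property distinct pairs have differences incongruent modulo `g * M`, while all of
  -- these lie in one class modulo `M`. The case `d = 0` is included.
  difference-pairs≤ : ∀ {X d} → SidonMod (g * M) X → ∀ P → Unique P →
    All (Difference M X d) P → length P ≤ g
  difference-pairs≤ {X} {d} sidon P P! Pd = subst (_≤ g) (length-map _ P)
    (class-size≤ (map (λ (u , v) → u ℤ.- v) P)
      (AllPairs.map⁺ (AllPairs.map distinct (AllPairs-All Pd P!)))
      (All.map⁺ (All.map (proj₂ ∘ proj₂ ∘ proj₂) Pd)))
    where
    distinct : ∀ {s t} → Difference M X d s × Difference M X d t × s ≢ t →
               ¬ proj₁ s ℤ.- proj₂ s ≅ proj₁ t ℤ.- proj₂ t [mod g * M ]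
    distinct ((u∈ , v∈ , u≢v , _) , (u′∈ , v′∈ , _) , s≢t) eq
      with refl , refl ← sidon u∈ v∈ u′∈ v′∈ u≢v eq = s≢t refl

  -- The kept elements stay original integers instead of being reduced modulo `M`, so that the Sidon
  -- property modulo `g * M` still applies to them.
  record Thinning (xs : List ℤ) : Set where
    field
      kept             : List ℤ
      collisions       : List (ℤ × ℤ)
      removed          : ℕ
      kept⊆            : All (_∈ xs) kept
      kept-incongruent : Incongruent M kept
      collisions!      : Unique collisions
      collisions-good  : All (Difference M xs 0ℤ) collisions
      length-collisions : length collisions ≡ removed + removed
      length-kept       : length xs ≡ removed + length kept

  thin : ∀ {xs} → Unique xs → Thinning xs
  thin [] = record
    { kept = [] ; collisions = [] ; removed = 0 ; kept⊆ = [] ; kept-incongruent = [] ; collisions! = []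
    ; collisions-good = [] ; length-collisions = refl ; length-kept = refl }
  thin {x ∷ xs} (x≢xs ∷ xs!) = extend (any? (x ≅?_[mod M ]) kept)
    where
    open Thinning (thin xs!)
    collisions-good′ : All (Difference M (x ∷ xs) 0ℤ) collisions
    collisions-good′ = All.map (λ (u∈ , v∈ , rest) → there u∈ , there v∈ , rest) collisions-good
    extend : Dec (Any (x ≅_[mod M ]) kept) → Thinning (x ∷ xs)
    extend (no x≇kept) = record
      { kept              = x ∷ kept
      ; collisions        = collisions
      ; removed           = removed
      ; kept⊆             = here refl ∷ All.map there kept⊆
      ; kept-incongruent  = All.¬Any⇒All¬ kept x≇kept ∷ kept-incongruent
      ; collisions!       = collisions!
      ; collisions-good   = collisions-good′
      ; length-collisions = length-collisions
      ; length-kept       = trans (cong suc length-kept) (sym (+-suc removed (length kept)))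
      }
    extend (yes x≅kept) with y , y∈ , x≅y ← find x≅kept = record
      { kept              = kept
      ; collisions        = (x , y) ∷ (y , x) ∷ collisions
      ; removed           = suc removed
      ; kept⊆             = All.map there kept⊆
      ; kept-incongruent  = kept-incongruent
      -- Both coordinates of every earlier pair lie in `xs`, which does not contain `x`; hence both
      -- new pairs are fresh.
      ; collisions!       = (x≢y ∘ cong proj₁ ∷ All.map (λ (u∈ , _) eq → x∉ (subst (_∈ xs) (sym (cong proj₁ eq)) u∈)) collisions-good)
                          ∷ All.map (λ (_ , v∈ , _) eq → x∉ (subst (_∈ xs) (sym (cong proj₂ eq)) v∈)) collisions-good
                          ∷ collisions!
      ; collisions-good   = (here refl , there y∈xs , x≢y , minus≅0⁺ x≅y)
                          ∷ (there y∈xs , here refl , x≢y ∘ sym , minus≅0⁺ (≅-sym x≅y))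
                          ∷ collisions-good′
      ; length-collisions = cong suc (trans (cong suc length-collisions) (sym (+-suc removed removed)))
      ; length-kept       = cong suc length-kept
      }
      where
      y∈xs : y ∈ xs
      y∈xs = All.lookup kept⊆ y∈
      x∉ : ¬ x ∈ xs
      x∉ x∈ = All.lookup x≢xs x∈ refl
      x≢y : x ≢ y
      x≢y refl = x∉ y∈xs

  -- Each element removed by the thinning gives two of the at most g
  -- pairs with difference 0 modulo M.
  removed≤ : ∀ {X} → SidonMod (g * M) X → (X! : Unique X) → Thinning.removed (thin X!) ≤ ⌊ g /2⌋
  removed≤ sidon X! = subst (_≤ ⌊ g /2⌋) (sym (n≡⌊n+n/2⌋ removed))
    (⌊n/2⌋-mono (subst (_≤ g) length-collisions (difference-pairs≤ sidon collisions collisions! collisions-good)))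
    where open Thinning (thin X!)

  module _ (Y : List ℤ) where

    representative : ℤ → ℤ
    representative u with any? (u ≅?_[mod M ]) Y
    ... | yes u≅Y = Any.lookup u≅Y
    -- A default value; `representative` is only used at integers congruent to an element of `Y`.
    ... | no  _   = 0ℤ

    representative-correct : ∀ {u} → u ∈[mod M ] Y → representative u ∈ Y × u ≅ representative u [mod M ]
    representative-correct {u} u∈Y with any? (u ≅?_[mod M ]) Y
    ... | yes u≅Y = ∈-lookup (Any.index u≅Y) , lookup-result u≅Y
    ... | no ¬u≅Y = contradiction u∈Y ¬u≅Y

    -- Representatives in `Y` carry the pairs back to `difference-pairs≤`. Incongruent first
    -- coordinates have different representatives, so no two lifted pairs coincide.
    residue-pairs≤ : ∀ {d} → SidonMod (g * M) Y → ∀ P → AllPairs (λ s t → ¬ proj₁ s ≅ proj₁ t [mod M ]) P →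
      All (ResidueDifference M Y d) P → length P ≤ g
    residue-pairs≤ {d} sidon P P≇ Pd = subst (_≤ g) (length-map lift P)
      (difference-pairs≤ sidon (map lift P)
        (AllPairs.map⁺ (AllPairs.map distinct (AllPairs-All Pd P≇)))
        (All.map⁺ (All.map good Pd)))
      where
      ρ = representative
      lift : ℤ × ℤ → ℤ × ℤ
      lift (u , v) = ρ v , ρ u
      distinct : ∀ {s t} → ResidueDifference M Y d s × ResidueDifference M Y d t × ¬ proj₁ s ≅ proj₁ t [mod M ] →
                 lift s ≢ lift t
      distinct ((u∈ , _) , (u′∈ , _) , u≇u′) eq = u≇u′ (≅-trans (proj₂ (representative-correct u∈))
        (≅-trans (≅-reflexive (cong proj₂ eq)) (≅-sym (proj₂ (representative-correct u′∈)))))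
      good : ∀ {s} → ResidueDifference M Y d s → Difference M Y d (lift s)
      good {u , v} (u∈ , v∈ , u≇v , v-u≅d) =
        let ρu∈ , u≅ = representative-correct u∈
            ρv∈ , v≅ = representative-correct v∈
        in ρv∈ , ρu∈ , (λ eq → u≇v (≅-trans u≅ (≅-trans (≅-reflexive (sym eq)) (≅-sym v≅)))) ,
           ≅-trans (≅-sym (minus-cong {x = v} {ρ v} {u} {ρ u} v≅ u≅)) v-u≅d

-- Decidability of the existence of rulers

module _ {a b p q} {A : Set a} {B : Set b} {P : Pred B p} {Q : Pred A q}
         (P? : Decidable P) (Q? : Decidable Q) (f : A → B) where

  length-filter-map : (∀ x → P (f x) → Q x) → (∀ x → Q x → P (f x)) → ∀ xs →
                      length (filter P? (map f xs)) ≡ length (filter Q? xs)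
  length-filter-map P⇒Q Q⇒P [] = refl
  length-filter-map P⇒Q Q⇒P (x ∷ xs) with P? (f x) | Q? x
  ... | yes _   | yes _  = cong suc (length-filter-map P⇒Q Q⇒P xs)
  ... | no  _   | no  _  = length-filter-map P⇒Q Q⇒P xs
  ... | yes Pfx | no ¬Qx = contradiction (P⇒Q x Pfx) ¬Qx
  ... | no ¬Pfx | yes Qx = contradiction (Q⇒P x Qx) ¬Pfx

module _ {a b} {A : Set a} {B : Set b} (f : A → B) where

  cartesianProduct-map : ∀ xs ys →
    cartesianProduct (map f xs) (map f ys) ≡ map (Product.map f f) (cartesianProduct xs ys)
  cartesianProduct-map []       ys = refl
  cartesianProduct-map (x ∷ xs) ys = begin
    map (f x ,_) (map f ys) ++ cartesianProduct (map f xs) (map f ys)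
      ≡⟨ cong₂ _++_ (trans (sym (map-∘ ys)) (map-∘ ys)) (cartesianProduct-map xs ys) ⟩
    map (Product.map f f) (map (x ,_) ys) ++ map (Product.map f f) (cartesianProduct xs ys)
      ≡⟨ map-++ (Product.map f f) (map (x ,_) ys) (cartesianProduct xs ys) ⟨
    map (Product.map f f) (cartesianProduct (x ∷ xs) ys) ∎
    where open ≡-Reasoning

differenceCount-map : ∀ f → (∀ x y → f y ℤ.- f x ≡ y ℤ.- x) → ∀ d 𝒢 →
                      differenceCount d (map f 𝒢) ≡ differenceCount d 𝒢
differenceCount-map f f-isometry d 𝒢 =
  trans (cong (length ∘ filter (λ (x , y) → y ℤ.- x ℤ.≟ d)) (cartesianProduct-map f 𝒢 𝒢))
    (length-filter-map _ _ (Product.map f f) (λ (x , y) → trans (sym (f-isometry x y)))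
      (λ (x , y) → trans (f-isometry x y)) (cartesianProduct 𝒢 𝒢))

translate-isometry : ∀ t x y → y ℤ.- t ℤ.- (x ℤ.- t) ≡ y ℤ.- x
translate-isometry = solve-∀

translate-injective : ∀ t {x y} → x ℤ.- t ≡ y ℤ.- t → x ≡ y
translate-injective t {x} {y} eq = trans (sym (restore x t)) (trans (cong (ℤ._+ t) eq) (restore y t))
  where
  restore : ∀ x t → x ℤ.- t ℤ.+ t ≡ x
  restore = solve-∀

IsGolombRuler-translate : ∀ {g 𝒢} t → IsGolombRuler g 𝒢 → IsGolombRuler g (map (ℤ._- t) 𝒢)
IsGolombRuler-translate {g} {𝒢} t ruler = record
  { unique  = Unique.map⁺ (translate-injective t) unique
  ; bounded = λ d 0<d → subst (_≤ g) (sym (differenceCount-map (ℤ._- t) (translate-isometry t) (+ d) 𝒢)) (bounded d 0<d)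
  }
  where open IsGolombRuler ruler

HasDiameter-translate : ∀ {𝒢 D} t → HasDiameter 𝒢 D → HasDiameter (map (ℤ._- t) 𝒢) D
HasDiameter-translate t diameter = record
  { min        = min ℤ.- t
  ; max        = max ℤ.- t
  ; min∈       = ∈-map⁺ (ℤ._- t) min∈
  ; max∈       = ∈-map⁺ (ℤ._- t) max∈
  ; min≤       = All.map⁺ (All.map (ℤ.+-monoˡ-≤ (ℤ.- t)) min≤)
  ; ≤max       = All.map⁺ (All.map (ℤ.+-monoˡ-≤ (ℤ.- t)) ≤max)
  ; difference = trans (translate-isometry t min max) difference
  }
  where open HasDiameter diameter

hasDiameter? : ∀ 𝒢 D → Dec (HasDiameter 𝒢 D)
hasDiameter? 𝒢 D = Dec.map′ to from
  (any? (λ min → All.all? (min ℤ.≤?_) 𝒢 ×-dec any? (λ max → All.all? (ℤ._≤? max) 𝒢 ×-dec max ℤ.- min ℤ.≟ + D) 𝒢) 𝒢)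
  where
  Extrema : Set
  Extrema = Any (λ min → All (min ℤ.≤_) 𝒢 × Any (λ max → All (ℤ._≤ max) 𝒢 × max ℤ.- min ≡ + D) 𝒢) 𝒢

  to : Extrema → HasDiameter 𝒢 D
  to found
    with min , min∈ , min≤ , found′ ← find found
    with max , max∈ , ≤max , difference ← find found′ =
    record { min = min ; max = max ; min∈ = min∈ ; max∈ = max∈ ; min≤ = min≤ ; ≤max = ≤max ; difference = difference }

  from : HasDiameter 𝒢 D → Extrema
  from diameter = lose min∈ (min≤ , lose max∈ (≤max , difference))
    where open HasDiameter diameter

differences≤diameter : ∀ {𝒢 D} → HasDiameter 𝒢 D → ∀ {x y} → x ∈ 𝒢 → y ∈ 𝒢 → y ℤ.- x ℤ.≤ + D
differences≤diameter diameter {x} {y} x∈ y∈ = subst (y ℤ.- x ℤ.≤_) difference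
  (ℤ.+-mono-≤ (All.lookup ≤max y∈) (ℤ.neg-mono-≤ (All.lookup min≤ x∈)))
  where open HasDiameter diameter

-- The diameter makes the quantifier over `d` finite: a difference above `D` never occurs.
isGolombRuler? : ∀ g {𝒢 D} → HasDiameter 𝒢 D → Dec (IsGolombRuler g 𝒢)
isGolombRuler? g {𝒢} {D} diameter = Dec.map′ to from
  (AllPairs.allPairs? (λ x y → ¬? (x ℤ.≟ y)) 𝒢 ×-dec
   allUpTo? (λ d → (0 <? d) →-dec (differenceCount (+ d) 𝒢 ≤? g)) (suc D))
  where
  extend : (∀ {d} → d < suc D → 0 < d → differenceCount (+ d) 𝒢 ≤ g) → ∀ d → 0 < d → differenceCount (+ d) 𝒢 ≤ g
  extend bounded′ d 0<d with d ≤? D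
  ... | yes d≤D = bounded′ (s≤s d≤D) 0<d
  ... | no  d≰D = ≤-trans (≤-reflexive (cong length (filter-none _ (All.tabulate λ {xy} → too-far {xy})))) z≤n
    where
    too-far : ∀ {(x , y) : ℤ × ℤ} → (x , y) ∈ cartesianProduct 𝒢 𝒢 → y ℤ.- x ≢ + d
    too-far xy∈ y-x≡d with x∈ , y∈ ← ∈-cartesianProduct⁻ 𝒢 𝒢 xy∈ =
      d≰D (ℤ.drop‿+≤+ (subst (ℤ._≤ + D) y-x≡d (differences≤diameter diameter x∈ y∈)))

  to : Unique 𝒢 × (∀ {d} → d < suc D → 0 < d → differenceCount (+ d) 𝒢 ≤ g) → IsGolombRuler g 𝒢
  to (unique , bounded) = record { unique = unique ; bounded = extend bounded }
  from : IsGolombRuler g 𝒢 → Unique 𝒢 × (∀ {d} → d < suc D → 0 < d → differenceCount (+ d) 𝒢 ≤ g)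
  from ruler = IsGolombRuler.unique ruler , λ {d} _ → IsGolombRuler.bounded ruler d

module _ {a} {A : Set a} where

  words : ℕ → List A → List (List A)
  words zero    as = [] ∷ []
  words (suc n) as = cartesianProductWith _∷_ as (words n as)

  ∈-words : ∀ {as xs} → All (_∈ as) xs → xs ∈ words (length xs) as
  ∈-words []           = here refl
  ∈-words (x∈as ∷ xs⊆) = ∈-cartesianProductWith⁺ _∷_ x∈as (∈-words xs⊆)

-- Every ruler of diameter D has a translate with marks in {0, …, D}.
isRulerDiameter? : ∀ g n D → Dec (IsRulerDiameter g n D)
isRulerDiameter? g n D = Dec.map′ to from (any? good? (words n marks))
  where
  marks : List ℤ
  marks = map +_ (upTo (suc D))

  Good : List ℤ → Set
  Good 𝒢 = HasDiameter 𝒢 D × IsGolombRuler g 𝒢 × length 𝒢 ≡ n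

  good? : Decidable Good
  good? 𝒢 with hasDiameter? 𝒢 D
  ... | no ¬diameter  = no (¬diameter ∘ proj₁)
  ... | yes diameter = Dec.map′ (diameter ,_) proj₂ (isGolombRuler? g diameter ×-dec length 𝒢 ≟ n)

  to : Any Good (words n marks) → IsRulerDiameter g n D
  to found with 𝒢 , _ , diameter , ruler , length≡n ← find found = 𝒢 , ruler , length≡n , diameter

  from : IsRulerDiameter g n D → Any Good (words n marks)
  from (𝒢 , ruler , length≡n , diameter) =
    lose (subst (λ k → 𝒢₀ ∈ words k marks) length≡ (∈-words (All.map⁺ (All.tabulate mark))))
      (HasDiameter-translate min diameter , IsGolombRuler-translate min ruler , length≡)
    where
    open HasDiameter diameter
    𝒢₀ : List ℤ
    𝒢₀ = map (ℤ._- min) 𝒢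
    length≡ : length 𝒢₀ ≡ n
    length≡ = trans (length-map _ 𝒢) length≡n
    mark : ∀ {x} → x ∈ 𝒢 → x ℤ.- min ∈ marks
    mark {x} x∈ with x ℤ.- min | ℤ.i≤j⇒0≤j-i (All.lookup min≤ x∈) | differences≤diameter diameter min∈ x∈
    ... | + k | _ | ℤ.+≤+ k≤D = ∈-map⁺ +_ (∈-upTo⁺ (s≤s k≤D))

G-exists : ∀ {g n D} → IsRulerDiameter g n D → ∃[ m ] IsG g n m × m ≤ D
G-exists {g} {n} {D} attained with m , attained′ , minimal ← least (isRulerDiameter? g n) D attained =
  m , record { attained = attained′ ; minimal = minimal } , minimal attained

-- Sums of naturals with bounded multiplicities

module _ {a p q} {A : Set a} {P : Pred A p} {Q : Pred A q} (P? : Decidable P) (Q? : Decidable Q) where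

  length-filter-mono : ∀ {xs} → All (λ x → P x → Q x) xs → length (filter P? xs) ≤ length (filter Q? xs)
  length-filter-mono [] = z≤n
  length-filter-mono {x ∷ _} (P⇒Q ∷ Ps⇒Qs) with P? x | Q? x
  ... | yes _  | yes _  = s≤s (length-filter-mono Ps⇒Qs)
  ... | yes Px | no ¬Qx = contradiction (P⇒Q Px) ¬Qx
  ... | no  _  | yes _  = m≤n⇒m≤1+n (length-filter-mono Ps⇒Qs)
  ... | no  _  | no  _  = length-filter-mono Ps⇒Qs

  length-filter-⊎ : ∀ {r} {R : Pred A r} (R? : Decidable R) → (∀ x → P x → Q x ⊎ R x) → ∀ xs →
                    length (filter P? xs) ≤ length (filter Q? xs) + length (filter R? xs)
  length-filter-⊎ R? P⇒Q⊎R [] = z≤n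
  length-filter-⊎ R? P⇒Q⊎R (x ∷ xs) with ih ← length-filter-⊎ R? P⇒Q⊎R xs | P? x | Q? x | R? x
  ... | no  _  | no  _  | no  _  = ih
  ... | no  _  | no  _  | yes _  = ≤-trans ih (+-monoʳ-≤ (length (filter Q? xs)) (n≤1+n _))
  ... | no  _  | yes _  | no  _  = m≤n⇒m≤1+n ih
  ... | no  _  | yes _  | yes _  = m≤n⇒m≤1+n (≤-trans ih (+-monoʳ-≤ (length (filter Q? xs)) (n≤1+n _)))
  ... | yes _  | yes _  | no  _  = s≤s ih
  ... | yes _  | yes _  | yes _  = s≤s (≤-trans ih (+-monoʳ-≤ (length (filter Q? xs)) (n≤1+n _)))
  ... | yes _  | no  _  | yes _  = ≤-trans (s≤s ih) (≤-reflexive (sym (+-suc _ _)))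
  ... | yes Px | no ¬Qx | no ¬Rx = contradiction (P⇒Q⊎R x Px) Sum.[ ¬Qx , ¬Rx ]

multiplicity : ℕ → List ℕ → ℕ
multiplicity j hs = length (filter (_≟ j) hs)

-- Raising the threshold adds 1 for each entry `h ≤ a`; for larger `h` both truncated differences
-- are 0.
sum-suc∸ : ∀ a hs → sum (map (suc a ∸_) hs) ≡ sum (map (a ∸_) hs) + length (filter (_≤? a) hs)
sum-suc∸ a [] = refl
sum-suc∸ a (h ∷ hs) with h ≤? a
... | yes h≤a rewrite filter-accept (_≤? a) {xs = hs} h≤a = begin
  suc a ∸ h + sum (map (suc a ∸_) hs)                                   ≡⟨ cong₂ _+_ (+-∸-assoc 1 h≤a) (sum-suc∸ a hs) ⟩
  suc (a ∸ h) + (sum (map (a ∸_) hs) + length (filter (_≤? a) hs))      ≡⟨ identity (a ∸ h) (sum (map (a ∸_) hs)) (length (filter (_≤? a) hs)) ⟩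
  a ∸ h + sum (map (a ∸_) hs) + suc (length (filter (_≤? a) hs))        ∎
  where
  open ≡-Reasoning
  identity : ∀ x y z → suc x + (y + z) ≡ x + y + suc z
  identity = ℕ.solve-∀
... | no h≰a rewrite filter-reject (_≤? a) {xs = hs} h≰a
  | m≤n⇒m∸n≡0 {suc a} {h} (≰⇒> h≰a) | m≤n⇒m∸n≡0 {a} {h} (<⇒≤ (≰⇒> h≰a)) = sum-suc∸ a hs

module _ {g : ℕ} {hs : List ℕ} (multiplicity≤g : ∀ j → multiplicity j hs ≤ g) where

  length-filter-≤ : ∀ a → length (filter (_≤? a) hs) ≤ suc a * g
  length-filter-≤ zero = ≤-trans (≤-reflexive (cong length (filter-≐ (_≤? 0) (_≟ 0) (n≤0⇒n≡0 , ≤-reflexive) hs)))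
    (≤-trans (multiplicity≤g 0) (≤-reflexive (sym (+-identityʳ g))))
  length-filter-≤ (suc a) = ≤-trans (length-filter-⊎ (_≤? suc a) (_≤? a) (_≟ suc a) ≤suc⇒ hs)
    (≤-trans (+-mono-≤ (length-filter-≤ a) (multiplicity≤g (suc a))) (≤-reflexive (+-comm (suc a * g) g)))
    where
    ≤suc⇒ : ∀ h → h ≤ suc a → h ≤ a ⊎ h ≡ suc a
    ≤suc⇒ h h≤1+a = Sum.map₁ s≤s⁻¹ (m≤n⇒m<n∨m≡n h≤1+a)

  -- The sum of the `a ∸ h` is the sum over `k < a` of the number of entries `h ≤ k`, each at most
  -- `suc k * g`. Doubling avoids the division in `g a (a + 1) / 2`.
  sum-∸≤ : ∀ a → 2 * sum (map (a ∸_) hs) ≤ g * (a * suc a)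
  sum-∸≤ zero = ≤-reflexive (trans (cong (2 *_) (vanish hs)) (sym (*-zeroʳ g)))
    where
    vanish : ∀ hs → sum (map (0 ∸_) hs) ≡ 0
    vanish []       = refl
    vanish (h ∷ hs) = cong₂ _+_ (0∸n≡0 h) (vanish hs)
  sum-∸≤ (suc a) = begin
    2 * sum (map (suc a ∸_) hs)                                             ≡⟨ cong (2 *_) (sum-suc∸ a hs) ⟩
    2 * (sum (map (a ∸_) hs) + length (filter (_≤? a) hs))                  ≡⟨ *-distribˡ-+ 2 (sum (map (a ∸_) hs)) (length (filter (_≤? a) hs)) ⟩
    2 * sum (map (a ∸_) hs) + 2 * length (filter (_≤? a) hs)                ≤⟨ +-mono-≤ (sum-∸≤ a) (*-monoʳ-≤ 2 (length-filter-≤ a)) ⟩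
    g * (a * suc a) + 2 * (suc a * g)                                       ≡⟨ identity g a ⟩
    g * (suc a * suc (suc a))                                               ∎
    where
    open ≤-Reasoning
    identity : ∀ g a → g * (a * suc a) + 2 * (suc a * g) ≡ g * (suc a * suc (suc a))
    identity = ℕ.solve-∀

  length*≤ : ∀ a → length hs * a ≤ sum hs + sum (map (a ∸_) hs)
  length*≤ a = go hs
    where
    open ≤-Reasoning
    interchange : ∀ u v w x → u + v + (w + x) ≡ u + w + (v + x)
    interchange = ℕ.solve-∀
    go : ∀ hs → length hs * a ≤ sum hs + sum (map (a ∸_) hs)
    go []       = z≤n
    go (h ∷ hs) = begin
      a + length hs * a                                ≤⟨ +-mono-≤ (m≤n+m∸n a h) (go hs) ⟩
      h + (a ∸ h) + (sum hs + sum (map (a ∸_) hs))     ≡⟨ interchange h (a ∸ h) (sum hs) (sum (map (a ∸_) hs)) ⟩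
      h + sum hs + (a ∸ h + sum (map (a ∸_) hs))       ∎

  sum≥ : ∀ {a r} → length hs ≡ a * g + r → g * a * (a ∸ 1) / 2 + r * a ≤ sum hs
  sum≥ {a} {r} length≡ = *-cancelʳ-≤ _ _ 2 (+-cancelʳ-≤ (g * (a * suc a)) _ _ (begin
    (T / 2 + r * a) * 2 + g * (a * suc a)      ≡⟨ cong (_+ g * (a * suc a)) (*-distribʳ-+ 2 (T / 2) (r * a)) ⟩
    T / 2 * 2 + r * a * 2 + g * (a * suc a)    ≤⟨ +-monoˡ-≤ (g * (a * suc a)) (+-monoˡ-≤ (r * a * 2) (m/n*n≤m T 2)) ⟩
    T + r * a * 2 + g * (a * suc a)            ≡⟨ identity g a r ⟩
    2 * ((a * g + r) * a)                      ≡⟨ cong (λ n → 2 * (n * a)) length≡ ⟨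
    2 * (length hs * a)                        ≤⟨ *-monoʳ-≤ 2 (length*≤ a) ⟩
    2 * (sum hs + sum (map (a ∸_) hs))         ≡⟨ *-distribˡ-+ 2 (sum hs) (sum (map (a ∸_) hs)) ⟩
    2 * sum hs + 2 * sum (map (a ∸_) hs)       ≤⟨ +-mono-≤ (≤-reflexive (*-comm 2 (sum hs))) (sum-∸≤ a) ⟩
    sum hs * 2 + g * (a * suc a)               ∎))
    where
    open ≤-Reasoning
    T : ℕ
    T = g * a * (a ∸ 1)
    identity : ∀ g a r → g * a * (a ∸ 1) + r * a * 2 + g * (a * suc a) ≡ 2 * ((a * g + r) * a)
    -- The truncated `a ∸ 1` computes only after a case split, which leaves two semiring identities.
    identity g zero    r = base g r
      where
      base : ∀ g r → g * 0 * 0 + r * 0 * 2 + g * 0 ≡ 2 * (r * 0)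
      base = ℕ.solve-∀
    identity g (suc a) r = step g a r
      where
      step : ∀ g a r → g * suc a * a + r * suc a * 2 + g * (suc a * suc (suc a)) ≡ 2 * ((suc a * g + r) * suc a)
      step = ℕ.solve-∀

sum-complement : ∀ {ℓ ws} → All (_≤ ℓ) ws → sum ws + sum (map (ℓ ∸_) ws) ≡ length ws * ℓ
sum-complement {ℓ} [] = refl
sum-complement {ℓ} {w ∷ ws} (w≤ℓ ∷ ws≤ℓ) = begin
  w + sum ws + (ℓ ∸ w + sum (map (ℓ ∸_) ws))   ≡⟨ interchange w (sum ws) (ℓ ∸ w) (sum (map (ℓ ∸_) ws)) ⟩
  w + (ℓ ∸ w) + (sum ws + sum (map (ℓ ∸_) ws)) ≡⟨ cong₂ _+_ (m+[n∸m]≡n w≤ℓ) (sum-complement ws≤ℓ) ⟩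
  ℓ + length ws * ℓ                            ∎
  where
  open ≡-Reasoning
  interchange : ∀ u v w x → u + v + (w + x) ≡ u + w + (v + x)
  interchange = ℕ.solve-∀

-- Only an inequality holds: for `j > ℓ` no complement equals `j`, whereas `ℓ ∸ j` is 0 and may
-- occur in `ws`.
multiplicity-complement : ∀ {ℓ ws} → All (_≤ ℓ) ws → ∀ j → multiplicity j (map (ℓ ∸_) ws) ≤ multiplicity (ℓ ∸ j) ws
multiplicity-complement {ℓ} {ws} ws≤ℓ j = ≤-trans
  (≤-reflexive (length-filter-map (_≟ j) (λ w → ℓ ∸ w ≟ j) (ℓ ∸_) (λ _ → id) (λ _ → id) ws))
  (length-filter-mono (λ w → ℓ ∸ w ≟ j) (_≟ ℓ ∸ j)
    (All.map (λ w≤ℓ ℓ∸w≡j → trans (sym (m∸[m∸n]≡n w≤ℓ)) (cong (ℓ ∸_) ℓ∸w≡j)) ws≤ℓ))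

sum-bounded-multiplicity : ∀ {g ℓ ws a r} → (∀ j → multiplicity j ws ≤ g) → All (_≤ ℓ) ws → length ws ≡ a * g + r →
                           sum ws + (g * a * (a ∸ 1) / 2 + r * a) ≤ length ws * ℓ
sum-bounded-multiplicity {ℓ = ℓ} {ws} {a} {r} multiplicity≤g ws≤ℓ length≡ =
  ≤-trans (+-monoʳ-≤ (sum ws) (sum≥ {hs = map (ℓ ∸_) ws}
             (λ j → ≤-trans (multiplicity-complement ws≤ℓ j) (multiplicity≤g (ℓ ∸ j)))
             {a} {r} (trans (length-map _ ws) length≡)))
    (≤-reflexive (sum-complement ws≤ℓ))

-- Cyclic gaps of a residue set

-- Gaps are kept as pairs of endpoints, because the multiplicity bound counts pairs. The closing
-- endpoint `e` will be `z + M`, so that the last pair is the gap across the origin of the circle.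
steps : ℕ → ℕ → List ℕ → List (ℕ × ℕ)
steps e z []       = (z , e) ∷ []
steps e z (y ∷ ys) = (z , y) ∷ steps e y ys

gap : ℕ × ℕ → ℕ
gap (a , c) = c ∸ a

length-steps : ∀ e z zs → length (steps e z zs) ≡ length (z ∷ zs)
length-steps e z []       = refl
length-steps e z (y ∷ ys) = cong suc (length-steps e y ys)

sum-gaps : ∀ {e z zs} → AllPairs _<_ (z ∷ zs) → All (_< e) (z ∷ zs) → z + sum (map gap (steps e z zs)) ≡ e
sum-gaps {e} {z} {[]} _ (z<e ∷ []) = trans (cong (_+_ z) (+-identityʳ (e ∸ z))) (m+[n∸m]≡n (<⇒≤ z<e))
sum-gaps {e} {z} {y ∷ ys} ((z<y ∷ _) ∷ ys<) (_ ∷ ys<e) = begin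
  z + (y ∸ z + sum (map gap (steps e y ys)))   ≡⟨ +-assoc z (y ∸ z) _ ⟨
  z + (y ∸ z) + sum (map gap (steps e y ys))   ≡⟨ cong (_+ sum (map gap (steps e y ys))) (m+[n∸m]≡n (<⇒≤ z<y)) ⟩
  y + sum (map gap (steps e y ys))             ≡⟨ sum-gaps ys< ys<e ⟩
  e                                            ∎
  where open ≡-Reasoning

record IsStep (e : ℕ) (zs : List ℕ) (s : ℕ × ℕ) : Set where
  field
    start∈    : proj₁ s ∈ zs
    end∈      : proj₂ s ∈ zs ⊎ proj₂ s ≡ e
    start<end : proj₁ s < proj₂ s
    empty     : All (λ w → w ≤ proj₁ s ⊎ proj₂ s ≤ w) zs

steps-IsStep : ∀ {e z zs} → AllPairs _<_ (z ∷ zs) → All (_< e) (z ∷ zs) → All (IsStep e (z ∷ zs)) (steps e z zs)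
steps-IsStep {zs = []} _ (z<e ∷ []) =
  record { start∈ = here refl ; end∈ = inj₂ refl ; start<end = z<e ; empty = inj₁ ≤-refl ∷ [] } ∷ []
steps-IsStep {e} {z} {y ∷ ys} (z<@(z<y ∷ _) ∷ ys<@(y< ∷ _)) (_ ∷ ys<e) =
  record
    { start∈ = here refl ; end∈ = inj₁ (there (here refl)) ; start<end = z<y
    ; empty = inj₁ ≤-refl ∷ inj₂ ≤-refl ∷ All.map (inj₂ ∘ <⇒≤) y< }
  ∷ All.map extend (steps-IsStep ys< ys<e)
  where
  extend : ∀ {s} → IsStep e (y ∷ ys) s → IsStep e (z ∷ y ∷ ys) s
  extend step = record
    { start∈ = there start∈ ; end∈ = Sum.map₁ there end∈ ; start<end = start<end
    ; empty = inj₁ (<⇒≤ (All.lookup z< start∈)) ∷ empty }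
    where open IsStep step

steps-starts : ∀ {e z zs} → AllPairs _<_ (z ∷ zs) → AllPairs (λ s t → proj₁ s < proj₁ t) (steps e z zs)
steps-starts {zs = []} _ = [] ∷ []
steps-starts {e} {z} {y ∷ ys} (z< ∷ ys<) = starts-later e y ys z< ∷ steps-starts ys<
  where
  starts-later : ∀ e y ys → All (z <_) (y ∷ ys) → All (λ t → z < proj₁ t) (steps e y ys)
  starts-later e y []       (z<y ∷ [])  = z<y ∷ []
  starts-later e y (w ∷ ws) (z<y ∷ z<) = z<y ∷ starts-later e w ws z<

-- Rulers from residue sets

≅∈⇒≡ : ∀ {m xs} → Incongruent m xs → ∀ {x y} → x ∈ xs → y ∈ xs → x ≅ y [mod m ] → x ≡ y
≅∈⇒≡ (_ ∷ _)   (here refl) (here refl) _   = refl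
≅∈⇒≡ (x≇ ∷ _)  (here refl) (there y∈)  x≅y = contradiction x≅y (All.lookup x≇ y∈)
≅∈⇒≡ (y≇ ∷ _)  (there x∈)  (here refl) x≅y = contradiction (≅-sym x≅y) (All.lookup y≇ x∈)
≅∈⇒≡ (_ ∷ xs≇) (there x∈)  (there y∈)  x≅y = ≅∈⇒≡ xs≇ x∈ y∈ x≅y

module _ {g M : ℕ} .{{_ : NonZero g}} .{{_ : NonZero M}} {Y : List ℤ} (sidon : SidonMod (g * M) Y) where

  -- Marks at a positive distance are distinct, hence incongruent modulo `M`, so the Sidon bound
  -- applies. Two pairs with the same difference and congruent first marks share that mark and
  -- therefore coincide.
  incongruent⇒IsGolombRuler : ∀ {𝒢} → Incongruent M 𝒢 → All (_∈[mod M ] Y) 𝒢 → IsGolombRuler g 𝒢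
  incongruent⇒IsGolombRuler {𝒢} 𝒢≇ 𝒢∈ = record
    { unique  = unique
    ; bounded = λ d 0<d → residue-pairs≤ Y sidon (pairs d)
        (AllPairs.map distinct (AllPairs-All (All.tabulate id)
          (Unique.filter⁺ (is-difference d) (Unique.cartesianProduct⁺ unique unique))))
        (All.tabulate λ {s} → residueDifference {d} {s} 0<d)
    }
    where
    unique : Unique 𝒢
    unique = AllPairs.map (λ x≇y x≡y → x≇y (≅-reflexive x≡y)) 𝒢≇

    is-difference : ∀ d → Decidable {A = ℤ × ℤ} (λ (x , y) → y ℤ.- x ≡ + d)
    is-difference d (x , y) = y ℤ.- x ℤ.≟ + d

    pairs : ℕ → List (ℤ × ℤ)
    pairs d = filter (is-difference d) (cartesianProduct 𝒢 𝒢)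

    ∈pairs⁻ : ∀ {d x y} → (x , y) ∈ pairs d → x ∈ 𝒢 × y ∈ 𝒢 × y ℤ.- x ≡ + d
    ∈pairs⁻ {d} {x} {y} xy∈ with xy∈′ , y-x≡d ← ∈-filter⁻ (is-difference d) {x , y} {cartesianProduct 𝒢 𝒢} xy∈
      with x∈ , y∈ ← ∈-cartesianProduct⁻ 𝒢 𝒢 xy∈′ = x∈ , y∈ , y-x≡d

    distinct : ∀ {d s t} → s ∈ pairs d × t ∈ pairs d × s ≢ t → ¬ proj₁ s ≅ proj₁ t [mod M ]
    distinct {d} {x , y} {x′ , y′} (s∈ , t∈ , s≢t) x≅x′
      with x∈ , _ , y-x≡d ← ∈pairs⁻ {d} s∈ | x′∈ , _ , y′-x′≡d ← ∈pairs⁻ {d} t∈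
      with refl ← ≅∈⇒≡ 𝒢≇ x∈ x′∈ x≅x′ = s≢t (cong (x ,_) (translate-injective x (trans y-x≡d (sym y′-x′≡d))))

    residueDifference : ∀ {d s} → 0 < d → s ∈ pairs d → ResidueDifference M Y (+ d) s
    residueDifference {d} {x , y} 0<d s∈ with x∈ , y∈ , y-x≡d ← ∈pairs⁻ {d} s∈ =
      All.lookup 𝒢∈ x∈ , All.lookup 𝒢∈ y∈ ,
      (λ x≅y → <⇒≢ 0<d (sym (ℤ.+-injective (trans (sym y-x≡d) (ℤ.i≡j⇒i-j≡0 (sym (≅∈⇒≡ 𝒢≇ x∈ y∈ x≅y))))))) ,
      ≅-reflexive y-x≡d

  module Residues {z : ℕ} {zs : List ℕ} (ascending : AllPairs _<_ (z ∷ zs)) (zs<M : All (_< M) (z ∷ zs))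
                  (zs∈ : All (λ w → + w ∈[mod M ] Y) (z ∷ zs)) where

    open IsStep

    end : ℕ
    end = z + M

    zs<end : All (_< end) (z ∷ zs)
    zs<end = All.map (λ w<M → <-≤-trans w<M (m≤n+m M z)) zs<M

    first≤ : All (z ≤_) (z ∷ zs)
    first≤ = ≤-refl ∷ All.map <⇒≤ (AllPairs.head ascending)

    all-steps : List (ℕ × ℕ)
    all-steps = steps end z zs

    +M≅ : ∀ w → + (w + M) ≅ + w [mod M ]
    +M≅ w = mk≅ 1ℤ (trans (ℤ.pos-+ w M) (cong (ℤ._+_ (+ w)) (sym (ℤ.*-identityˡ (+ M)))))

    end≤ : ∀ {s} → IsStep end (z ∷ zs) s → proj₂ s ≤ end
    end≤ step with end∈ step
    ... | inj₁ c∈   = <⇒≤ (All.lookup zs<end c∈)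
    ... | inj₂ refl = ≤-refl

    end≤start+M : ∀ {s} → IsStep end (z ∷ zs) s → proj₂ s ≤ proj₁ s + M
    end≤start+M step = ≤-trans (end≤ step) (+-monoˡ-≤ M (All.lookup first≤ (start∈ step)))

    end-residue : ∀ {s} → IsStep end (z ∷ zs) s → + proj₂ s ∈[mod M ] Y
    end-residue step with end∈ step
    ... | inj₁ c∈   = All.lookup zs∈ c∈
    ... | inj₂ refl = Any.map (≅-trans (+M≅ z)) (All.head zs∈)

    -- Separates off the gap of length `M`, whose endpoints are congruent and which `residue-pairs≤`
    -- does not cover. With a second residue every inner step stays below `M`, and the closing step
    -- to `z + M` starts above `z`.
    short⊎single : zs ≡ [] ⊎ All (λ s → proj₂ s < proj₁ s + M) all-steps
    short⊎single = go ascending zs<M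
      where
      later : ∀ {y ys} → z < y → AllPairs _<_ (y ∷ ys) → All (_< M) (y ∷ ys) →
        All (λ s → proj₂ s < proj₁ s + M) (steps end y ys)
      later {ys = []}     z<y _                    _             = +-monoˡ-< M z<y ∷ []
      later {y} {w ∷ ys}  z<y ((y<w ∷ _) ∷ ys<) (_ ∷ ys<M@(w<M ∷ _)) =
        <-≤-trans w<M (m≤n+m M y) ∷ later (<-trans z<y y<w) ys< ys<M
      go : ∀ {ys} → AllPairs _<_ (z ∷ ys) → All (_< M) (z ∷ ys) →
        ys ≡ [] ⊎ All (λ s → proj₂ s < proj₁ s + M) (steps end z ys)
      go {[]}     _ _ = inj₁ refl
      go {y ∷ ys} ((z<y ∷ _) ∷ ys<) (_ ∷ ys<M@(y<M ∷ _)) = inj₂ (<-≤-trans y<M (m≤n+m M z) ∷ later z<y ys< ys<M)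

    multiplicity-gaps≤ : ∀ d → multiplicity d (map gap all-steps) ≤ g
    multiplicity-gaps≤ d = ≤-trans
      (≤-reflexive (length-filter-map (_≟ d) has-gap gap (λ _ → id) (λ _ → id) all-steps)) (bound short⊎single)
      where
      has-gap : Decidable (λ s → gap s ≡ d)
      has-gap s = gap s ≟ d

      selected : List (ℕ × ℕ)
      selected = filter has-gap all-steps

      embed : ℕ × ℕ → ℤ × ℤ
      embed (a , c) = + a , + c

      steps-good : All (IsStep end (z ∷ zs)) all-steps
      steps-good = steps-IsStep ascending zs<end

      bound : zs ≡ [] ⊎ All (λ s → proj₂ s < proj₁ s + M) all-steps → length selected ≤ g
      -- A single residue has a single gap, and `g` is at least 1.
      bound (inj₁ zs≡[]) = ≤-trans (length-filter has-gap all-steps)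
        (≤-trans (≤-reflexive (trans (length-steps end z zs) (cong (suc ∘ length) zs≡[]))) (>-nonZero⁻¹ g))
      bound (inj₂ short) = subst (_≤ g) (length-map embed selected)
        (residue-pairs≤ Y sidon (map embed selected)
          (AllPairs.map⁺ (AllPairs.filter⁺ has-gap (AllPairs.map distinct (AllPairs-All steps-good (steps-starts ascending)))))
          (All.map⁺ (All.tabulate difference)))
        where
        distinct : ∀ {s t} → IsStep end (z ∷ zs) s × IsStep end (z ∷ zs) t × proj₁ s < proj₁ t →
          ¬ + proj₁ s ≅ + proj₁ t [mod M ]
        distinct (s-step , t-step , s<t) s≅t =
          <⇒≢ s<t (≅⇒≡ (All.lookup zs<M (start∈ s-step)) (All.lookup zs<M (start∈ t-step)) s≅t)

        difference : ∀ {s} → s ∈ selected → ResidueDifference M Y (+ d) (embed s)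
        difference {s@(a , c)} s∈ with s∈′ , c∸a≡d ← ∈-filter⁻ has-gap {s} {all-steps} s∈ =
          All.lookup zs∈ (start∈ step) , end-residue step , a≇c ,
          ≅-reflexive (trans (ℤ.m-n≡m⊖n c a) (trans (ℤ.⊖-≥ (<⇒≤ (start<end step))) (cong +_ c∸a≡d)))
          where
          step : IsStep end (z ∷ zs) s
          step = All.lookup steps-good s∈′
          a≇c : ¬ + a ≅ + c [mod M ]
          a≇c a≅c = <⇒≱ (+-cancelˡ-< a _ _ (subst (_< a + M) (sym (m+[n∸m]≡n (<⇒≤ (start<end step)))) (All.lookup short s∈′)))
            (∣⇒≤ {{>-nonZero (m<n⇒0<n∸m (start<end step))}} (≅⇒∣∸ (<⇒≤ (start<end step)) (≅-sym a≅c)))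

    module _ {s : ℕ × ℕ} (step : IsStep end (z ∷ zs) s) where

      private
        a c : ℕ
        a = proj₁ s
        c = proj₂ s

      -- The marks are read off starting at the end of the gap s.
      mark : ℕ → ℕ
      mark w with c ≤? w
      ... | yes _ = w
      ... | no  _ = w + M

      mark≅ : ∀ w → + mark w ≅ + w [mod M ]
      mark≅ w with c ≤? w
      ... | yes _ = ≅-refl
      ... | no  _ = +M≅ w

      end≤mark : ∀ {w} → w ∈ z ∷ zs → c ≤ mark w
      end≤mark {w} w∈ with c ≤? w
      ... | yes c≤w = c≤w
      ... | no  _   = ≤-trans (end≤ step) (+-monoˡ-≤ M (All.lookup first≤ w∈))

      mark≤start+M : ∀ {w} → w ∈ z ∷ zs → mark w ≤ a + M
      mark≤start+M {w} w∈ with c ≤? w | All.lookup (empty step) w∈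
      ... | yes _  | _        = ≤-trans (<⇒≤ (All.lookup zs<M w∈)) (m≤n+m M a)
      ... | no _   | inj₁ w≤a = +-monoˡ-≤ M w≤a
      ... | no c≰w | inj₂ c≤w = contradiction c≤w c≰w

      mark-start : mark a ≡ a + M
      mark-start with c ≤? a
      ... | yes c≤a = contradiction c≤a (<⇒≱ (start<end step))
      ... | no  _   = refl

      end-marked : ∃[ w ] w ∈ z ∷ zs × mark w ≡ c
      end-marked with end∈ step
      ... | inj₁ c∈ = c , c∈ , mark-end
        where
        mark-end : mark c ≡ c
        mark-end with c ≤? c
        ... | yes _   = refl
        ... | no  c≰c = contradiction ≤-refl c≰c
      -- When the cut is the gap across the origin, its end `z + M` exceeds every residue; all marks
      -- are shifted by `M`, and the first one becomes the end.
      ... | inj₂ c≡end = z , here refl , trans mark-first (sym c≡end)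
        where
        mark-first : mark z ≡ end
        mark-first with c ≤? z
        ... | yes c≤z = contradiction (subst (_≤ z) c≡end c≤z) (<⇒≱ (m<m+n z (>-nonZero⁻¹ M)))
        ... | no  _   = refl

      ruler : List ℤ
      ruler = map (+_ ∘ mark) (z ∷ zs)

      ruler-golomb : IsGolombRuler g ruler
      ruler-golomb = incongruent⇒IsGolombRuler
        (AllPairs.map⁺ (AllPairs.map distinct (AllPairs-All zs<M ascending)))
        (All.map⁺ (All.map (λ {w} → Any.map (≅-trans (mark≅ w))) zs∈))
        where
        distinct : ∀ {v w} → v < M × w < M × v < w → ¬ + mark v ≅ + mark w [mod M ]
        distinct {v} {w} (v<M , w<M , v<w) eq =
          <⇒≢ v<w (≅⇒≡ v<M w<M (≅-trans (≅-sym (mark≅ v)) (≅-trans eq (mark≅ w))))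

      ruler-diameter : HasDiameter ruler (M ∸ gap s)
      ruler-diameter = record
        { min        = + c
        ; max        = + (a + M)
        ; min∈       = let w , w∈ , mark-w≡c = end-marked in subst (λ x → + x ∈ ruler) mark-w≡c (∈-map⁺ (+_ ∘ mark) w∈)
        ; max∈       = subst (λ x → + x ∈ ruler) mark-start (∈-map⁺ (+_ ∘ mark) (start∈ step))
        ; min≤       = All.map⁺ {f = +_ ∘ mark} (All.tabulate (ℤ.+≤+ ∘ end≤mark))
        ; ≤max       = All.map⁺ {f = +_ ∘ mark} (All.tabulate (ℤ.+≤+ ∘ mark≤start+M))
        ; difference = trans (ℤ.m-n≡m⊖n (a + M) c) (trans (ℤ.⊖-≥ (end≤start+M step)) (cong +_ regroup))
        }
        where
        regroup : a + M ∸ c ≡ M ∸ (c ∸ a)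
        regroup = trans (cong (a + M ∸_) (sym (m+[n∸m]≡n (<⇒≤ (start<end step))))) ([m+n]∸[m+o]≡n∸o a M (c ∸ a))

      rulerDiameter : IsRulerDiameter g (length (z ∷ zs)) (M ∸ gap s)
      rulerDiameter = ruler , ruler-golomb , length-map _ (z ∷ zs) , ruler-diameter

    large-gap : ∀ {b r} → length (z ∷ zs) ≡ b * g + r →
      ∃[ ℓ ] ℓ ≤ M × IsRulerDiameter g (length (z ∷ zs)) (M ∸ ℓ) ×
        M + (g * b * (b ∸ 1) / 2 + r * b) ≤ length (z ∷ zs) * ℓ
    large-gap {b} {r} length≡ = gap widest , m≤n+o⇒m∸n≤o _ _ (end≤start+M widest-step) , rulerDiameter widest-step , (begin
      M + T                               ≡⟨ cong (_+ T) (+-cancelˡ-≡ z _ _ (sum-gaps ascending zs<end)) ⟨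
      sum gaps + T                        ≤⟨ bounded ⟩
      length gaps * gap widest            ≡⟨ cong (_* gap widest) length-gaps ⟩
      length (z ∷ zs) * gap widest        ∎)
      where
      open ≤-Reasoning
      T : ℕ
      T = g * b * (b ∸ 1) / 2 + r * b

      gaps : List ℕ
      gaps = map gap all-steps

      length-gaps : length gaps ≡ length (z ∷ zs)
      length-gaps = trans (length-map gap all-steps) (length-steps end z zs)

      widest-of : ∀ ss → 0 < length ss → All (IsStep end (z ∷ zs)) ss →
                  ∃[ s ] IsStep end (z ∷ zs) s × All (λ t → gap t ≤ gap s) ss
      widest-of (s ∷ ss) _ (s-step ∷ ss-steps) = argmax gap s ss , argmax-all gap s-step ss-steps ,
        f[⊥]≤f[argmax] {f = gap} s ss ∷ f[xs]≤f[argmax] {f = gap} s ss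

      found : ∃[ s ] IsStep end (z ∷ zs) s × All (λ t → gap t ≤ gap s) all-steps
      found = widest-of all-steps (subst (0 <_) (sym (length-steps end z zs)) z<s) (steps-IsStep ascending zs<end)

      widest : ℕ × ℕ
      widest = proj₁ found

      widest-step : IsStep end (z ∷ zs) widest
      widest-step = proj₁ (proj₂ found)

      gaps≤ : All (λ t → gap t ≤ gap widest) all-steps
      gaps≤ = proj₂ (proj₂ found)

      bounded : sum gaps + T ≤ length gaps * gap widest
      bounded = sum-bounded-multiplicity {g} {gap widest} {gaps} {b} {r}
        multiplicity-gaps≤ (All.map⁺ gaps≤) (trans length-gaps length≡)

-- From a Sidon set to a short ruler and the bound

sorted-residues : ∀ {M} .{{_ : NonZero M}} {Y} → Incongruent M Y →
  ∃[ zs ] AllPairs _<_ zs × All (_< M) zs × All (λ w → + w ∈[mod M ] Y) zs × length zs ≡ length Y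
sorted-residues {M} {Y} Y≇ = sort residues , ascending ,
  All-resp-↭ (↭-sym (sort-↭ residues)) (All.map⁺ (All.tabulate λ {y} _ → ℤ.n%ℕd<d y M)) ,
  All-resp-↭ (↭-sym (sort-↭ residues)) (All.map⁺ (All.tabulate λ {y} y∈ → lose y∈ (%ℕ-≅ y))) ,
  trans (↭-length (sort-↭ residues)) (length-map (ℤ._%ℕ M) Y)
  where
  residues : List ℕ
  residues = map (ℤ._%ℕ M) Y

  residues! : Unique residues
  residues! = AllPairs.map⁺ (AllPairs.map (λ x≇y → x≇y ∘ %ℕ-injective) Y≇)

  ascending : AllPairs _<_ (sort residues)
  ascending = AllPairs.zipWith (λ (x≤y , x≢y) → ≤∧≢⇒< x≤y x≢y)
    (Sorted⇒AllPairs ≤-totalOrder (sort-↗ residues) ,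
     Unique-resp-↭ (setoid ℕ) (↭⇒↭ₛ (↭-sym (sort-↭ residues))) residues!)

-- The ceiling is minus the floor of `- k / n`. From `- ℓ n ≤ - k < (floor + 1) n` follows
-- `- ℓ < floor + 1`, that is `- ℓ ≤ floor`.
ceiling-/≤ : ∀ {k n ℓ} .{{_ : NonZero n}} → k ≤ n * ℓ → ⌈ + k ℚᵘ./ n ⌉ ℤ.≤ + ℓ
ceiling-/≤ {k} {n@(suc _)} {ℓ} k≤nℓ =
  subst (⌈ + k ℚᵘ./ n ⌉ ℤ.≤_) (ℤ.neg-involutive (+ ℓ)) (ℤ.neg-mono-≤ -ℓ≤floor)
  where
  open ℤ.≤-Reasoning
  floor : ℤ
  floor = ℤ.- + k ℤ./ + n
  -ℓ≤floor : ℤ.- + ℓ ℤ.≤ floor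
  -ℓ≤floor = subst (ℤ.- + ℓ ℤ.≤_) (ℤ.pred-suc floor)
    (ℤ.i<j⇒i≤pred[j] {j = ℤ.suc floor} (ℤ.*-cancelʳ-<-nonNeg (+ n) (begin-strict
    ℤ.- + ℓ ℤ.* + n              ≡⟨ ℤ.neg-distribˡ-* (+ ℓ) (+ n) ⟨
    ℤ.- (+ ℓ ℤ.* + n)            ≡⟨ cong ℤ.-_ (trans (ℤ.*-comm (+ ℓ) (+ n)) (sym (ℤ.pos-* n ℓ))) ⟩
    ℤ.- + (n * ℓ)                ≤⟨ ℤ.neg-mono-≤ (ℤ.+≤+ k≤nℓ) ⟩
    ℤ.- + k                      <⟨ ℤ.n<s[n/ℕd]*d (ℤ.- + k) n ⟩
    ℤ.suc (ℤ.- + k ℤ./ℕ n) ℤ.* + n ≡⟨ cong (λ t → ℤ.suc t ℤ.* + n) (ℤ.div-pos-is-/ℕ (ℤ.- + k) n) ⟨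
    ℤ.suc floor ℤ.* + n          ∎)))

sidon⇒short-ruler : ∀ {g M n a r X} .{{_ : NonZero g}} .{{_ : NonZero M}} .{{_ : NonZero n}} →
  SidonMod (g * M) X → Unique X → n ≤ length X ∸ ⌊ g /2⌋ → n ≡ a * g + r →
  ∃[ ℓ ] ℓ ≤ M × IsRulerDiameter g n (M ∸ ℓ) × M + (g * a * (a ∸ 1) / 2 + r * a) ≤ n * ℓ
sidon⇒short-ruler {g} {M} {n} {a} {r} {X} sidon X! n≤ n≡ag+r =
  conclude (sorted-residues (AllPairs.take⁺ n kept-incongruent))
  where
  open Thinning (thin {g} {M} X!)

  Y : List ℤ
  Y = take n kept

  n≤length-kept : n ≤ length kept
  n≤length-kept = ≤-trans n≤ (≤-trans (∸-monoʳ-≤ (length X) (removed≤ {g} {M} sidon X!))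
    (≤-reflexive (trans (cong (_∸ removed) length-kept) (m+n∸m≡n removed (length kept)))))

  length-Y : length Y ≡ n
  length-Y = trans (length-take n kept) (m≤n⇒m⊓n≡m n≤length-kept)

  conclude : ∃[ zs ] AllPairs _<_ zs × All (_< M) zs × All (λ w → + w ∈[mod M ] Y) zs × length zs ≡ length Y →
             ∃[ ℓ ] ℓ ≤ M × IsRulerDiameter g n (M ∸ ℓ) × M + (g * a * (a ∸ 1) / 2 + r * a) ≤ n * ℓ
  conclude ([] , _ , _ , _ , length≡) = contradiction (trans length≡ length-Y) (<⇒≢ (>-nonZero⁻¹ n))
  conclude (z ∷ zs , ascending , zs<M , zs∈ , length≡) = subst
    (λ n → ∃[ ℓ ] ℓ ≤ M × IsRulerDiameter g n (M ∸ ℓ) × M + (g * a * (a ∸ 1) / 2 + r * a) ≤ n * ℓ)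
    (trans length≡ length-Y)
    (Residues.large-gap {g} {M} {Y} (SidonMod-⊆ (All.take⁺ n kept⊆) sidon) ascending zs<M zs∈
      {a} {r} (trans length≡ (trans length-Y n≡ag+r)))

theorem8 : ∀ (p g n a r : ℕ) .{{_ : NonZero g}} .{{_ : NonZero n}} →
    Prime p → ¬ (2 ∣ p) →
    g ∣ p * (p ∸ 1) →
    n ≤ p ∸ 1 ∸ ⌊ g /2⌋ →
    n ≡ a * g + r → r < g →
    ∃[ m ] IsG g n m ×
    + m ℤ.≤ + (p * (p ∸ 1) / g) ℤ.- ⌈ + (p * (p ∸ 1) / g + g * a * (a ∸ 1) / 2 + r * a) ℚᵘ./ n ⌉
theorem8 zero g n a r p-prime _ _ _ _ _ = contradiction p-prime ¬prime[0]
-- Matching `p` as `suc q` lets `p ∸ 1` compute to `q`, the order of `θ` and the number of Ruzsa's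
-- residues.
theorem8 p@(suc q) g n a r p-prime _ g∣pq n≤ n≡ag+r _ = conclude (proj₂ (primitive-root p-prime))
  where
  M : ℕ
  M = p * q / g

  gM≡pq : g * M ≡ p * q
  gM≡pq = m*[n/m]≡n g∣pq

  instance
    q≢0 : NonZero q
    q≢0 = >-nonZero (s≤s⁻¹ (1<p p-prime))
    M≢0 : NonZero M
    M≢0 = m*n≢0⇒n≢0 g {{subst NonZero (sym gM≡pq) (m*n≢0 p q)}}

  bound : ∀ {ℓ m} → ℓ ≤ M → M + (g * a * (a ∸ 1) / 2 + r * a) ≤ n * ℓ → m ≤ M ∸ ℓ →
          + m ℤ.≤ + M ℤ.- ⌈ + (M + g * a * (a ∸ 1) / 2 + r * a) ℚᵘ./ n ⌉
  bound {ℓ} {m} ℓ≤M large m≤ = begin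
    + m          ≤⟨ ℤ.+≤+ m≤ ⟩
    + (M ∸ ℓ)    ≡⟨ trans (ℤ.m-n≡m⊖n M ℓ) (ℤ.⊖-≥ ℓ≤M) ⟨
    + M ℤ.- + ℓ  ≤⟨ ℤ.+-monoʳ-≤ (+ M) (ℤ.neg-mono-≤ (ceiling-/≤ (subst (_≤ n * ℓ) (sym (+-assoc M _ (r * a))) large))) ⟩
    + M ℤ.- ⌈ + (M + g * a * (a ∸ 1) / 2 + r * a) ℚᵘ./ n ⌉ ∎
    where open ℤ.≤-Reasoning

  conclude : ∀ {θ} → HasOrder p θ q →
    ∃[ m ] IsG g n m × + m ℤ.≤ + M ℤ.- ⌈ + (M + g * a * (a ∸ 1) / 2 + r * a) ℚᵘ./ n ⌉
  conclude θ-primitive =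
    let open Ruzsa p-prime θ-primitive
        ℓ , ℓ≤M , ruler , large = sidon⇒short-ruler {g} {M} {n} {a} {r}
          (subst (λ N → SidonMod N elements) (sym gM≡pq) elements-sidon)
          elements-unique (subst (λ k → n ≤ k ∸ ⌊ g /2⌋) (sym (trans (length-map element (upTo q)) (length-upTo q))) n≤) n≡ag+r
        m , isG , m≤ = G-exists ruler
    in m , isG , bound ℓ≤M large m≤
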